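{- Let $r_1,\ldots,r_s$ be positive integers and let $G$ be a graph of order $n\ge 2\alpha'+2$, matching number $\alpha'$ and minimum degree $\delta(G)\ge k$. Then $$N(K_{r_1,\ldots,r_s},G)\le \max\{g_{r_1,\ldots,r_s}(n,2\alpha',k),\ g_{r_1,\ldots,r_s}(n,2\alpha',\alpha')\}.$$
   Context: The matching number of a graph is the maximum size of a set of pairwise disjoint edges. For positive integers $r_1,\ldots,r_s$, $K_{r_1,\ldots,r_s}$ denotes the complete multipartite graph with $s$ parts of sizes $r_1,\ldots,r_s$. For graphs $H$ and $G$, $N(H,G)$ denotes the number of subgraphs of $G$ isomorphic to $H$. For integers $n,c,k$ with $k\ge 0$ and $n-1\ge c\ge 2k$, let $G(n,c,k)=K_k\vee\left(K_{c+1-2k}+\overline{K_{n-c-1+k}}\right)$, where $\vee$ denotes join (disjoint union plus all edges between the two graphs), $+$ denotes disjoint union, $K_m$ is the complete graph on $m$ vertices ($K_0$ empty), and $\overline{K_m}$ is the edgeless graph on $m$ vertices. Define $g_{r_1,\ldots,r_s}(n,c,k)=N(K_{r_1,\ldots,r_s},G(n,c,k))$. -}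

module Defs where

open import Data.Nat using (ℕ; zero; suc; _+_; _*_; _∸_; _≤_; _<ᵇ_; _≡ᵇ_)
open import Data.Bool using (Bool; true; false; not; _∧_; _∨_; _xor_; if_then_else_)
open import Data.Bool.Properties using (∧-comm)
open import Data.Fin using (Fin; toℕ; splitAt)
open import Data.Fin.Properties using () renaming (_≟_ to _≟ᶠ_)
open import Data.List using (List; []; _∷_; concatMap; map; allFin; foldr)
open import Data.Nat.ListAction using (sum)
open import Data.Vec using (Vec; []; _∷_; lookup)
open import Data.Product using (_×_; _,_; proj₁; proj₂; Σ; ∃)
open import Data.Sum using ([_,_])
open import Relation.Nullary using (¬_; does)
open import Relation.Binary.PropositionalEquality using (_≡_; _≢_; refl; cong; cong₂)

record SimpleGraph (n : ℕ) : Set where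
  field
    adj    : Fin n → Fin n → Bool
    sym    : ∀ i j → adj i j ≡ adj j i
    irrefl : ∀ i → adj i i ≡ false
open SimpleGraph public

allB : (n : ℕ) → (Fin n → Bool) → Bool
allB n p = foldr (λ i b → p i ∧ b) true (allFin n)

anyB : (n : ℕ) → (Fin n → Bool) → Bool
anyB n p = foldr (λ i b → p i ∨ b) false (allFin n)

_⇒ᵇ_ : Bool → Bool → Bool
a ⇒ᵇ b = not a ∨ b

_⇔ᵇ_ : Bool → Bool → Bool
a ⇔ᵇ b = not (a xor b)

_=ᶠ_ : ∀ {n} → Fin n → Fin n → Bool
i =ᶠ j = does (i ≟ᶠ j)

countB : ∀ {A : Set} → (A → Bool) → List A → ℕ
countB p xs = sum (map (λ x → if p x then 1 else 0) xs)

vecsOver : ∀ {A : Set} → List A → (m : ℕ) → List (Vec A m)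
vecsOver xs zero    = [] ∷ []
vecsOver xs (suc m) = concatMap (λ v → map (λ x → x ∷ v) xs) (vecsOver xs m)

degree : ∀ {n} → SimpleGraph n → Fin n → ℕ
degree {n} G v = countB (adj G v) (allFin n)

MinDegreeAtLeast : ∀ {n} → SimpleGraph n → ℕ → Set
MinDegreeAtLeast G k = ∀ v → k ≤ degree G v

IsMatching : ∀ {n} → SimpleGraph n → (t : ℕ) → (Fin t → Fin n × Fin n) → Set
IsMatching G t M =
  (∀ e → adj G (proj₁ (M e)) (proj₂ (M e)) ≡ true) ×
  (∀ e e′ → e ≢ e′ →
     (proj₁ (M e) ≢ proj₁ (M e′)) × (proj₁ (M e) ≢ proj₂ (M e′)) ×
     (proj₂ (M e) ≢ proj₁ (M e′)) × (proj₂ (M e) ≢ proj₂ (M e′)))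

MatchingNumber : ∀ {n} → SimpleGraph n → ℕ → Set
MatchingNumber {n} G α′ =
  (Σ (Fin α′ → Fin n × Fin n) (IsMatching G α′)) ×
  (∀ t (M : Fin t → Fin n × Fin n) → IsMatching G t M → t ≤ α′)

-- N(H, G): number of subgraphs of G isomorphic to H.
-- A subgraph of G is a pair (S , E): a vertex set S ⊆ V(G) and a symmetric
-- edge relation E ⊆ E(G) all of whose edges have both ends in S.

validSub : ∀ {n} → SimpleGraph n → Vec Bool n → Vec (Vec Bool n) n → Bool
validSub {n} G S E = allB n λ i → allB n λ j →
  (lookup (lookup E i) j ⇒ᵇ (adj G i j ∧ lookup S i ∧ lookup S j)) ∧
  (lookup (lookup E i) j ⇔ᵇ lookup (lookup E j) i)

isoTo : ∀ {m n} → SimpleGraph m → Vec Bool n → Vec (Vec Bool n) n → Bool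
isoTo {m} {n} H S E = foldr (λ φ b → ok φ ∨ b) false (vecsOver (allFin n) m)
  where
  ok : Vec (Fin n) m → Bool
  ok φ =
    (allB m λ i → allB m λ j → (lookup φ i =ᶠ lookup φ j) ⇒ᵇ (i =ᶠ j)) ∧
    (allB n λ v → lookup S v ⇔ᵇ anyB m (λ i → lookup φ i =ᶠ v)) ∧
    (allB m λ i → allB m λ j →
       adj H i j ⇔ᵇ lookup (lookup E (lookup φ i)) (lookup φ j))

subgraphs : (n : ℕ) → List (Vec Bool n × Vec (Vec Bool n) n)
subgraphs n = concatMap (λ S → map (λ E → S , E) (vecsOver (vecsOver (true ∷ false ∷ []) n) n))
                        (vecsOver (true ∷ false ∷ []) n)

N : ∀ {m n} → SimpleGraph m → SimpleGraph n → ℕ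
N {m} {n} H G = countB (λ p → validSub G (proj₁ p) (proj₂ p) ∧ isoTo H (proj₁ p) (proj₂ p)) (subgraphs n)

≡ᵇ-refl : ∀ a → (a ≡ᵇ a) ≡ true
≡ᵇ-refl zero = refl
≡ᵇ-refl (suc a) = ≡ᵇ-refl a

≡ᵇ-sym : ∀ a b → (a ≡ᵇ b) ≡ (b ≡ᵇ a)
≡ᵇ-sym zero zero = refl
≡ᵇ-sym zero (suc b) = refl
≡ᵇ-sym (suc a) zero = refl
≡ᵇ-sym (suc a) (suc b) = ≡ᵇ-sym a b

part : (rs : List ℕ) → Fin (sum rs) → ℕ
part []       ()
part (r ∷ rs) i = [ (λ _ → 0) , (λ j → suc (part rs j)) ] (splitAt r i)

K : (rs : List ℕ) → SimpleGraph (sum rs)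
K rs = record
  { adj    = λ i j → not (part rs i ≡ᵇ part rs j)
  ; sym    = λ i j → cong not (≡ᵇ-sym (part rs i) (part rs j))
  ; irrefl = λ i → cong not (≡ᵇ-refl (part rs i))
  }

-- G(n,c,k) = K_k ∨ (K_{c+1-2k} + complement K_{n-c-1+k}) on Fin n:
-- vertices 0..k-1 form the K_k, vertices k..c-k the K_{c+1-2k},
-- and vertices c+1-k..n-1 the independent set.

data Cls : Set where
  top clq ind : Cls

cls : ℕ → ℕ → ℕ → Cls
cls c k v = if v <ᵇ k then top else (if v <ᵇ (c + 1 ∸ k) then clq else ind)

link : Cls → Cls → Bool
link top _   = true
link clq top = true
link clq clq = true
link clq ind = false
link ind top = true
link ind clq = false
link ind ind = false

link-sym : ∀ a b → link a b ≡ link b a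
link-sym top top = refl
link-sym top clq = refl
link-sym top ind = refl
link-sym clq top = refl
link-sym clq clq = refl
link-sym clq ind = refl
link-sym ind top = refl
link-sym ind clq = refl
link-sym ind ind = refl

Gnck : (n c k : ℕ) → SimpleGraph n
Gnck n c k = record
  { adj    = λ u v → not (toℕ u ≡ᵇ toℕ v) ∧ link (cls c k (toℕ u)) (cls c k (toℕ v))
  ; sym    = λ u v → cong₂ (λ a b → not a ∧ b) (≡ᵇ-sym (toℕ u) (toℕ v))
                        (link-sym (cls c k (toℕ u)) (cls c k (toℕ v)))
  ; irrefl = λ u → cong (λ a → not a ∧ link (cls c k (toℕ u)) (cls c k (toℕ u))) (≡ᵇ-refl (toℕ u))
  }

g : (rs : List ℕ) → (n c k : ℕ) → ℕ
g rs n c k = N (K rs) (Gnck n c k)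

{-# OPTIONS --safe #-}
-- Copies of K = K_{r₁,…,r_s} are counted through embeddings, the ratio being the number of automorphisms of K.
-- Adding edges between nonadjacent vertices of degree sum above 2α′ creates no matching of size α′ + 1, so G may
-- be taken closed under this operation. Delete vertices with at most α′ remaining neighbours, one by one. Either
-- α′ + 1 vertices are reached, or the process stops at a core, which by closedness is a clique; it has
-- 2α′ + 1 - t vertices for some t < α′, and again by closedness all vertices outside it have degree at most t,
-- so k ≤ t. A deleted vertex with at most t neighbours among the m others destroys at most f t m embeddings, and
-- exactly that many in G(n, 2α′, t), because K is complete multipartite. Hence G has at most as many copies as
-- G(n, 2α′, t) with t = α′ or k ≤ t < α′, and this number is a convex function of t.
module Submission where

open import Defs
open import Data.Nat hiding (_≟_)
open import Data.Nat.Properties hiding (_≟_)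
import Data.Nat.Properties as ℕₚ
open import Data.Nat.ListAction using (sum)
open import Data.Nat.ListAction.Properties using (sum-++)
open import Data.Nat.Tactic.RingSolver using (solve-∀)
open import Data.Bool using (Bool; true; false; not; _∧_; _∨_; if_then_else_)
open import Data.Bool.Properties using (∨-comm; ¬-not) renaming (_≟_ to _≟ᵇ_)
open import Data.Fin as Fin using (Fin; zero; suc; toℕ)
open import Data.Fin.Properties as Finₚ using (any?; all?) renaming (_≟_ to _≟ᶠ_)
open import Data.List as List using (List; []; _∷_; _++_; map; concatMap; allFin; length; foldr)
open import Data.List.Properties using (map-tabulate; map-++; map-∘; length-tabulate)
open import Data.List.Membership.Propositional using (_∈_; _∉_)
open import Data.List.Membership.Propositional.Properties using (∈-allFin)
open import Data.List.Relation.Unary.Any using (here; there)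
open import Data.List.Relation.Unary.All as All using (All; []; _∷_)
open import Data.List.Relation.Unary.AllPairs using (AllPairs; []; _∷_)
open import Data.List.Relation.Unary.Unique.Propositional using (Unique)
open import Data.Vec as Vec using (Vec; []; _∷_; lookup)
open import Data.Vec.Properties using (lookup∘tabulate; tabulate∘lookup; tabulate-cong; lookup-map)
open import Data.Product using (_×_; _,_; proj₁; proj₂; ∃)
open import Data.Sum using (_⊎_; inj₁; inj₂)
open import Data.Empty using (⊥; ⊥-elim)
open import Function using (_∘_; id)
open import Relation.Nullary using (Dec; yes; no; ¬_; does)
open import Relation.Nullary.Decidable using (dec-true; dec-false; _×-dec_; _→-dec_; ¬?)
open import Relation.Unary using (Decidable)
open import Relation.Binary.Definitions using (DecidableEquality)
open import Relation.Binary.PropositionalEquality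
  using (_≡_; _≢_; refl; cong; cong₂; trans; subst; subst₂; module ≡-Reasoning)
  renaming (sym to ≡-sym)

-- Only inequalities against one explicit function are proved: `F n c t` bounds the embeddings of
-- the closed graph from above and those of G(n, 2c, t) from below, and convexity is shown for `F`
-- instead of the number of copies. A deleted vertex is charged for its own edges only. Nothing is
-- lost by this when its neighbours are adjacent to all other vertices, because the nonneighbours of
-- an index of K are mutually nonadjacent. The size 2α′ + 1 - t comes from closedness: in a clique
-- on w vertices all degrees are at least w - 1, so an outside vertex of degree above 2α′ + 1 - w
-- would be joined to the whole clique, although it kept at most α′ neighbours there. The deletion
-- is therefore run twice, with threshold α′ merely to find the core, and with threshold t down to
-- the core to count. If no core appears, the α′ + 1 vertices that are left need no structure, and
-- 2α′ + 1 - α′ = α′ + 1 makes this the bound for t = α′.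

private variable
  A B P : Set
  m n r : ℕ

-- Finite sums and enumerations

⟦_⟧ : Bool → ℕ
⟦ b ⟧ = if b then 1 else 0

𝟙 : Dec P → ℕ
𝟙 P? = ⟦ does P? ⟧

∑ : List A → (A → ℕ) → ℕ
∑ xs f = sum (map f xs)

𝟙-true : (P? : Dec P) → P → 𝟙 P? ≡ 1
𝟙-true P? p = cong ⟦_⟧ (dec-true P? p)

𝟙-false : (P? : Dec P) → ¬ P → 𝟙 P? ≡ 0
𝟙-false P? ¬p = cong ⟦_⟧ (dec-false P? ¬p)

𝟙≤1 : (P? : Dec P) → 𝟙 P? ≤ 1
𝟙≤1 (yes _) = ≤-refl
𝟙≤1 (no _)  = z≤n

𝟙≤ : (P? : Dec P) → (P → 1 ≤ n) → 𝟙 P? ≤ n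
𝟙≤ (yes p) h = h p
𝟙≤ (no _)  h = z≤n

𝟙-mono : {Q : Set} (P? : Dec P) (Q? : Dec Q) → (P → Q) → 𝟙 P? ≤ 𝟙 Q?
𝟙-mono (yes p) Q? f = ≤-reflexive (≡-sym (𝟙-true Q? (f p)))
𝟙-mono (no _)  Q? f = z≤n

𝟙-cong : {Q : Set} (P? : Dec P) (Q? : Dec Q) → (P → Q) → (Q → P) → 𝟙 P? ≡ 𝟙 Q?
𝟙-cong P? Q? f g = ≤-antisym (𝟙-mono P? Q? f) (𝟙-mono Q? P? g)

⟦∧⟧ : ∀ a b → ⟦ a ∧ b ⟧ ≡ ⟦ a ⟧ * ⟦ b ⟧
⟦∧⟧ false b = refl
⟦∧⟧ true  b = ≡-sym (*-identityˡ ⟦ b ⟧)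

⟦⟧-mono : ∀ {a b} → (a ≡ true → b ≡ true) → ⟦ a ⟧ ≤ ⟦ b ⟧
⟦⟧-mono {false} f = z≤n
⟦⟧-mono {true}  f = ≤-reflexive (cong ⟦_⟧ (≡-sym (f refl)))

∑-cong : ∀ (xs : List A) {f g : A → ℕ} → (∀ x → f x ≡ g x) → ∑ xs f ≡ ∑ xs g
∑-cong []       h = refl
∑-cong (x ∷ xs) h = cong₂ _+_ (h x) (∑-cong xs h)

∑-mono : ∀ (xs : List A) {f g : A → ℕ} → (∀ x → f x ≤ g x) → ∑ xs f ≤ ∑ xs g
∑-mono []       h = z≤n
∑-mono (x ∷ xs) h = +-mono-≤ (h x) (∑-mono xs h)

∑-zero : ∀ (xs : List A) → ∑ xs (λ _ → 0) ≡ 0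
∑-zero []       = refl
∑-zero (x ∷ xs) = ∑-zero xs

∑-+ : ∀ (xs : List A) (f g : A → ℕ) → ∑ xs (λ x → f x + g x) ≡ ∑ xs f + ∑ xs g
∑-+ []       f g = refl
∑-+ (x ∷ xs) f g rewrite ∑-+ xs f g = interchange (f x) (g x) (∑ xs f) (∑ xs g)
  where
  interchange : ∀ a b c d → (a + b) + (c + d) ≡ (a + c) + (b + d)
  interchange = solve-∀

∑-*ʳ : ∀ (xs : List A) (f : A → ℕ) c → ∑ xs (λ x → f x * c) ≡ ∑ xs f * c
∑-*ʳ []       f c = refl
∑-*ʳ (x ∷ xs) f c rewrite ∑-*ʳ xs f c = ≡-sym (*-distribʳ-+ c (f x) (∑ xs f))

∑-*ˡ : ∀ (xs : List A) (f : A → ℕ) c → ∑ xs (λ x → c * f x) ≡ c * ∑ xs f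
∑-*ˡ xs f c = trans (∑-cong xs (λ x → *-comm c (f x)))
                    (trans (∑-*ʳ xs f c) (*-comm (∑ xs f) c))

∑-const : ∀ (xs : List A) c → ∑ xs (λ _ → c) ≡ length xs * c
∑-const []       c = refl
∑-const (x ∷ xs) c = cong (c +_) (∑-const xs c)

∑-swap : ∀ (xs : List A) (ys : List B) (f : A → B → ℕ) →
         ∑ xs (λ x → ∑ ys (f x)) ≡ ∑ ys (λ y → ∑ xs (λ x → f x y))
∑-swap []       ys f = ≡-sym (∑-zero ys)
∑-swap (x ∷ xs) ys f rewrite ∑-swap xs ys f = ≡-sym (∑-+ ys (f x) (λ y → ∑ xs (λ x → f x y)))

∑-concatMap : ∀ (xs : List A) (ys : List B) {C : Set} (k : A → B → C) (f : C → ℕ) →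
              ∑ (concatMap (λ x → map (k x) ys) xs) f ≡ ∑ xs (λ x → ∑ ys (λ y → f (k x y)))
∑-concatMap []       ys k f = refl
∑-concatMap (x ∷ xs) ys k f = begin
  sum (map f (map (k x) ys ++ concatMap (λ x → map (k x) ys) xs))
    ≡⟨ cong sum (map-++ f (map (k x) ys) _) ⟩
  sum (map f (map (k x) ys) ++ map f (concatMap (λ x → map (k x) ys) xs))
    ≡⟨ sum-++ (map f (map (k x) ys)) _ ⟩
  sum (map f (map (k x) ys)) + ∑ (concatMap (λ x → map (k x) ys) xs) f
    ≡⟨ cong₂ _+_ (cong sum (≡-sym (map-∘ ys))) (∑-concatMap xs ys k f) ⟩
  ∑ ys (λ y → f (k x y)) + ∑ xs (λ x → ∑ ys (λ y → f (k x y))) ∎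
  where open ≡-Reasoning

∑-vecsOver : ∀ (xs : List A) m (f : Vec A (suc m) → ℕ) →
             ∑ (vecsOver xs (suc m)) f ≡ ∑ xs (λ x → ∑ (vecsOver xs m) (λ v → f (x ∷ v)))
∑-vecsOver xs m f = trans (∑-concatMap (vecsOver xs m) xs (λ v x → x ∷ v) f)
                          (∑-swap (vecsOver xs m) xs (λ v x → f (x ∷ v)))

∑-allFin-suc : ∀ (f : Fin (suc m) → ℕ) → ∑ (allFin (suc m)) f ≡ f zero + ∑ (allFin m) (f ∘ suc)
∑-allFin-suc {m} f = cong (λ l → f zero + sum l)
  (trans (map-tabulate suc f) (≡-sym (map-tabulate id (f ∘ suc))))

∑-∈ : ∀ {xs : List A} (f : A → ℕ) {x} → x ∈ xs → f x ≤ ∑ xs f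
∑-∈ f {x} (here refl)       = m≤m+n (f x) _
∑-∈ f (there {x = y} x∈xs) = ≤-trans (∑-∈ f x∈xs) (m≤n+m _ (f y))

-- `once` says through a sum that each element is listed exactly once. In this form it turns the
-- indicator sum of a uniquely satisfied property into 1, which is what the double counting of
-- copies needs.
record Finite (A : Set) : Set where
  field
    elems : List A
    _≟_   : DecidableEquality A
    once  : ∀ x → ∑ elems (λ y → 𝟙 (x ≟ y)) ≡ 1

module Enumeration (F : Finite A) where
  open Finite F

  ∑-δ : ∀ x (f : A → ℕ) → ∑ elems (λ y → 𝟙 (x ≟ y) * f y) ≡ f x
  ∑-δ x f = begin
    ∑ elems (λ y → 𝟙 (x ≟ y) * f y) ≡⟨ ∑-cong elems at-x ⟩
    ∑ elems (λ y → 𝟙 (x ≟ y) * f x) ≡⟨ ∑-*ʳ elems _ (f x) ⟩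
    ∑ elems (λ y → 𝟙 (x ≟ y)) * f x ≡⟨ cong (_* f x) (once x) ⟩
    1 * f x                         ≡⟨ *-identityˡ (f x) ⟩
    f x                             ∎
    where
    open ≡-Reasoning
    at-x : ∀ y → 𝟙 (x ≟ y) * f y ≡ 𝟙 (x ≟ y) * f x
    at-x y with x ≟ y
    ... | yes refl = refl
    ... | no _     = refl

  ∑-unique : ∀ {P : A → Set} (P? : Decidable P) x → P x → (∀ y → P y → x ≡ y) →
             ∑ elems (λ y → 𝟙 (P? y)) ≡ 1
  ∑-unique P? x px uniq = trans
    (∑-cong elems (λ y → 𝟙-cong (P? y) (x ≟ y) (uniq y) (λ { refl → px })))
    (once x)

  ∑-none : ∀ {P : A → Set} (P? : Decidable P) → (∀ y → ¬ P y) → ∑ elems (λ y → 𝟙 (P? y)) ≡ 0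
  ∑-none P? none = trans (∑-cong elems (λ y → 𝟙-false (P? y) (none y))) (∑-zero elems)

  ∑-lower : ∀ (f : A → ℕ) x → f x ≤ ∑ elems f
  ∑-lower f x = begin
    f x                             ≡⟨ ∑-δ x f ⟨
    ∑ elems (λ y → 𝟙 (x ≟ y) * f y) ≤⟨ ∑-mono elems (λ y → ≤-trans (*-monoˡ-≤ (f y) (𝟙≤1 (x ≟ y))) (≤-reflexive (*-identityˡ (f y)))) ⟩
    ∑ elems f                       ∎
    where open ≤-Reasoning

finiteFin : ∀ n → Finite (Fin n)
finiteFin n = record { elems = allFin n ; _≟_ = _≟ᶠ_ ; once = once }
  where
  once : ∀ {n} (x : Fin n) → ∑ (allFin n) (λ y → 𝟙 (x ≟ᶠ y)) ≡ 1
  once {suc n} zero    = trans (∑-allFin-suc {n} (λ y → 𝟙 (zero ≟ᶠ y)))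
    (cong suc (trans (∑-cong (allFin n) (λ y → 𝟙-false (zero ≟ᶠ suc y) λ ())) (∑-zero (allFin n))))
  once {suc n} (suc x) = trans (∑-allFin-suc {n} (λ y → 𝟙 (suc x ≟ᶠ y)))
    (trans (∑-cong (allFin n) (λ y → 𝟙-cong (suc x ≟ᶠ suc y) (x ≟ᶠ y) Finₚ.suc-injective (cong suc)))
           (once x))

finiteBool : Finite Bool
finiteBool = record { elems = true ∷ false ∷ [] ; _≟_ = Data.Bool._≟_
                    ; once = λ { true → refl ; false → refl } }
  where import Data.Bool

module _ (F : Finite A) where
  open Finite F

  finiteVec : ∀ m → Finite (Vec A m)
  finiteVec m = record { elems = vecsOver elems m ; _≟_ = _≟ᵛ_ ; once = onceᵛ m }
    where
    open import Data.Vec.Properties using (≡-dec; ∷-injective)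
    open ≡-Reasoning
    _≟ᵛ_ : ∀ {m} → DecidableEquality (Vec A m)
    _≟ᵛ_ = ≡-dec _≟_

    head-tail : ∀ {m} (x y : A) (v w : Vec A m) → 𝟙 ((x ∷ v) ≟ᵛ (y ∷ w)) ≡ 𝟙 (x ≟ y) * 𝟙 (v ≟ᵛ w)
    head-tail x y v w = ⟦∧⟧ (does (x ≟ y)) (does (v ≟ᵛ w))

    onceᵛ : ∀ m (v : Vec A m) → ∑ (vecsOver elems m) (λ w → 𝟙 (v ≟ᵛ w)) ≡ 1
    onceᵛ zero    []      = refl
    onceᵛ (suc m) (x ∷ v) = begin
      ∑ (vecsOver elems (suc m)) (λ w → 𝟙 ((x ∷ v) ≟ᵛ w))
        ≡⟨ ∑-vecsOver elems m _ ⟩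
      ∑ elems (λ y → ∑ (vecsOver elems m) (λ w → 𝟙 ((x ∷ v) ≟ᵛ (y ∷ w))))
        ≡⟨ ∑-cong elems (λ y → trans (∑-cong (vecsOver elems m) (head-tail x y v)) (∑-*ˡ (vecsOver elems m) _ (𝟙 (x ≟ y)))) ⟩
      ∑ elems (λ y → 𝟙 (x ≟ y) * ∑ (vecsOver elems m) (λ w → 𝟙 (v ≟ᵛ w)))
        ≡⟨ ∑-cong elems (λ y → trans (cong (𝟙 (x ≟ y) *_) (onceᵛ m v)) (*-identityʳ _)) ⟩
      ∑ elems (λ y → 𝟙 (x ≟ y))
        ≡⟨ once x ⟩
      1 ∎

finite× : Finite A → Finite B → Finite (A × B)
finite× FA FB = record { elems = concatMap (λ x → map (x ,_) FB.elems) FA.elems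
                       ; _≟_ = _≟×_ ; once = once× }
  where
  module FA = Finite FA
  module FB = Finite FB
  open import Data.Product.Properties using (≡-dec; ,-injectiveˡ; ,-injectiveʳ)
  open ≡-Reasoning
  _≟×_ = ≡-dec FA._≟_ FB._≟_

  split : ∀ x y x′ y′ → 𝟙 ((x , y) ≟× (x′ , y′)) ≡ 𝟙 (x FA.≟ x′) * 𝟙 (y FB.≟ y′)
  split x y x′ y′ with x FA.≟ x′
  ... | no _     = refl
  ... | yes refl with y FB.≟ y′
  ...   | yes refl = refl
  ...   | no _     = refl

  once× : ∀ p → ∑ (concatMap (λ x → map (x ,_) FB.elems) FA.elems) (λ q → 𝟙 (p ≟× q)) ≡ 1
  once× (x , y) = begin
    ∑ (concatMap (λ x → map (x ,_) FB.elems) FA.elems) (λ q → 𝟙 ((x , y) ≟× q))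
      ≡⟨ ∑-concatMap FA.elems FB.elems _,_ _ ⟩
    ∑ FA.elems (λ x′ → ∑ FB.elems (λ y′ → 𝟙 ((x , y) ≟× (x′ , y′))))
      ≡⟨ ∑-cong FA.elems (λ x′ → trans (∑-cong FB.elems (split x y x′)) (∑-*ˡ FB.elems _ (𝟙 (x FA.≟ x′)))) ⟩
    ∑ FA.elems (λ x′ → 𝟙 (x FA.≟ x′) * ∑ FB.elems (λ y′ → 𝟙 (y FB.≟ y′)))
      ≡⟨ ∑-cong FA.elems (λ x′ → trans (cong (𝟙 (x FA.≟ x′) *_) (FB.once y)) (*-identityʳ _)) ⟩
    ∑ FA.elems (λ x′ → 𝟙 (x FA.≟ x′))
      ≡⟨ FA.once x ⟩
    1 ∎

open module ∑Fin {n} = Enumeration (finiteFin n) public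
  renaming (∑-δ to ∑Fin-δ; ∑-unique to ∑Fin-unique; ∑-none to ∑Fin-none; ∑-lower to ∑Fin-lower)

-- Falling factorials and the convex bound

ff : ℕ → ℕ → ℕ
ff n       zero    = 1
ff zero    (suc a) = 0
ff (suc n) (suc a) = suc n * ff n a

ff-head : ∀ n a → n * ff (n ∸ 1) a ≡ ff n (suc a)
ff-head zero    a = refl
ff-head (suc n) a = refl

-- With `a` places filled, `n ∸ a` choices are left for the last one. The subtracted term is moved
-- to the left, so that the case `n < a` is covered too: there every product vanishes.
ff-last : ∀ n a → ff n (suc a) + a * ff n a ≡ n * ff n a
ff-last zero    zero    = refl
ff-last zero    (suc a) = *-zeroʳ a
ff-last (suc n) zero    = +-identityʳ _
ff-last (suc n) (suc a) = begin
  suc n * ff n (suc a) + suc a * (suc n * ff n a)  ≡⟨ lem n a (ff n (suc a)) (ff n a) ⟩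
  suc n * ((ff n (suc a) + a * ff n a) + ff n a)   ≡⟨ cong (λ z → suc n * (z + ff n a)) (ff-last n a) ⟩
  suc n * (n * ff n a + ff n a)                    ≡⟨ lem′ n (ff n a) ⟩
  suc n * (suc n * ff n a)                         ∎
  where
  open ≡-Reasoning
  lem : ∀ n a x y → suc n * x + suc a * (suc n * y) ≡ suc n * ((x + a * y) + y)
  lem = solve-∀
  lem′ : ∀ n y → suc n * (n * y + y) ≡ suc n * (suc n * y)
  lem′ = solve-∀

-- An injection of `suc a` points into `suc n` either misses the new point or sends one of the
-- `suc a` arguments to it. This is the discrete derivative behind `ff-convex`.
ff-suc : ∀ n a → ff (suc n) (suc a) ≡ ff n (suc a) + suc a * ff n a
ff-suc n a = begin
  ff n a + n * ff n a                    ≡⟨ cong (ff n a +_) (ff-last n a) ⟨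
  ff n a + (ff n (suc a) + a * ff n a)   ≡⟨ rearrange (ff n a) (ff n (suc a)) a ⟩
  ff n (suc a) + suc a * ff n a          ∎
  where
  open ≡-Reasoning
  rearrange : ∀ x y a → x + (y + a * x) ≡ y + suc a * x
  rearrange = solve-∀

ff-mono : ∀ {m n} a → m ≤ n → ff m a ≤ ff n a
ff-mono zero    m≤n       = ≤-refl
ff-mono (suc a) z≤n       = z≤n
ff-mono (suc a) (s≤s m≤n) = *-mono-≤ (s≤s m≤n) (ff-mono a m≤n)

ff-zero : ∀ {n a} → n < a → ff n a ≡ 0
ff-zero {zero}  (s≤s _)   = refl
ff-zero {suc n} (s≤s n<a) = trans (cong (suc n *_) (ff-zero n<a)) (*-zeroʳ (suc n))

ff-add : ∀ n a b → ff n a * ff (n ∸ a) b ≡ ff n (a + b)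
ff-add n       zero    b = +-identityʳ _
ff-add zero    (suc a) b = refl
ff-add (suc n) (suc a) b = trans (*-assoc (suc n) (ff n a) _) (cong (suc n *_) (ff-add n a b))

-- By `ff-suc` the increment in `t` is a multiple of the falling factorial of one order less, hence
-- nondecreasing in `t`.
ff-convex : ∀ t a → 2 * ff (1 + t) a ≤ ff t a + ff (2 + t) a
ff-convex t zero    = ≤-refl
ff-convex t (suc a) = begin
  2 * ff (1 + t) (suc a)
    ≡⟨ double (ff (1 + t) (suc a)) ⟩
  ff (1 + t) (suc a) + ff (1 + t) (suc a)
    ≡⟨ cong (_+ ff (1 + t) (suc a)) (ff-suc t a) ⟩
  ff t (suc a) + suc a * ff t a + ff (1 + t) (suc a)
    ≤⟨ +-monoˡ-≤ (ff (1 + t) (suc a)) (+-monoʳ-≤ (ff t (suc a)) (*-monoʳ-≤ (suc a) (ff-mono a (n≤1+n t)))) ⟩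
  ff t (suc a) + suc a * ff (1 + t) a + ff (1 + t) (suc a)
    ≡⟨ rearrange (ff t (suc a)) (suc a * ff (1 + t) a) (ff (1 + t) (suc a)) ⟩
  ff t (suc a) + (ff (1 + t) (suc a) + suc a * ff (1 + t) a)
    ≡⟨ cong (ff t (suc a) +_) (ff-suc (1 + t) a) ⟨
  ff t (suc a) + ff (2 + t) (suc a) ∎
  where
  open ≤-Reasoning
  double : ∀ x → 2 * x ≡ x + x
  double = solve-∀
  rearrange : ∀ x y z → x + y + z ≡ x + (z + y)
  rearrange = solve-∀

-- Both sides place `a` indices confined to `t` vertices and one index free in all `u`. On the left
-- the free index goes first, inside or outside the `t` vertices; on the right it goes last.
ff-pick : ∀ {t u} a → t ≤ u → ff t (suc a) + (u ∸ t) * ff t a ≡ (u ∸ a) * ff t a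
ff-pick {t} {u} a t≤u with ≤-total a t
... | inj₁ a≤t = +-cancelʳ-≡ (a * ff t a) _ _ (begin
  ff t (suc a) + (u ∸ t) * ff t a + a * ff t a ≡⟨ rearrange (ff t (suc a)) ((u ∸ t) * ff t a) (a * ff t a) ⟩
  (u ∸ t) * ff t a + (ff t (suc a) + a * ff t a) ≡⟨ cong ((u ∸ t) * ff t a +_) (ff-last t a) ⟩
  (u ∸ t) * ff t a + t * ff t a                ≡⟨ *-distribʳ-+ (ff t a) (u ∸ t) t ⟨
  (u ∸ t + t) * ff t a                         ≡⟨ cong (_* ff t a) (m∸n+n≡m t≤u) ⟩
  u * ff t a                                   ≡⟨ cong (_* ff t a) (m∸n+n≡m (≤-trans a≤t t≤u)) ⟨
  (u ∸ a + a) * ff t a                         ≡⟨ *-distribʳ-+ (ff t a) (u ∸ a) a ⟩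
  (u ∸ a) * ff t a + a * ff t a                ∎)
  where
  open ≡-Reasoning
  rearrange : ∀ x y z → x + y + z ≡ y + (x + z)
  rearrange = solve-∀
... | inj₂ t≤a with m≤n⇒m<n∨m≡n t≤a
...   | inj₂ refl = cong (_+ (u ∸ t) * ff t t) (ff-zero (n<1+n t))
...   | inj₁ t<a  rewrite ff-zero t<a | ff-zero (m<n⇒m<1+n t<a) | *-zeroʳ (u ∸ t) | *-zeroʳ (u ∸ a) = refl

module Extremal (r : ℕ) (a b : Fin r → ℕ) (a+b : ∀ x → a x + b x + 1 ≡ r) where

  -- The embeddings gained when a vertex with t neighbours joins m others, if only its own edges matter:
  -- x is sent to it, the a x neighbours of x to its neighbourhood, the b x other indices anywhere.
  f : ℕ → ℕ → ℕ
  f t m = ∑ (allFin r) (λ x → ff t (a x) * ff (m ∸ a x) (b x))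

  -- A clique on w vertices to which j vertices with t neighbours each are added.
  grow : ℕ → ℕ → ℕ → ℕ
  grow t w zero    = ff w r
  grow t w (suc j) = grow t w j + f t (w + j)

  -- The value for G(n, 2c, t), whose clique part has 2c + 1 - t vertices.
  F : ℕ → ℕ → ℕ → ℕ
  F n c t = grow t (2 * c + 1 ∸ t) (n ∸ (2 * c + 1 ∸ t))

  f-mono : ∀ {t t′ m m′} → t ≤ t′ → m ≤ m′ → f t m ≤ f t′ m′
  f-mono t≤t′ m≤m′ = ∑-mono (allFin r) λ x →
    *-mono-≤ (ff-mono (a x) t≤t′) (ff-mono (b x) (∸-monoˡ-≤ (a x) m≤m′))

  -- Joining a vertex to a whole clique is the case `t = m = w` of `f`: the two factors merge by
  -- `ff-add`, and each of the `r` indices contributes `ff w (r ∸ 1)`. Clique vertices and added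
  -- vertices are thus measured by the same function.
  ff-step : ∀ w → ff (suc w) r ≡ ff w r + f w w
  ff-step w = go r refl
    where
    open ≡-Reasoning
    f-diag : f w w ≡ r * ff w (r ∸ 1)
    f-diag = begin
      f w w                                 ≡⟨ ∑-cong (allFin r) (λ x → trans (ff-add w (a x) (b x)) (cong (ff w) (at x))) ⟩
      ∑ (allFin r) (λ _ → ff w (r ∸ 1))     ≡⟨ ∑-const (allFin r) _ ⟩
      length (allFin r) * ff w (r ∸ 1)      ≡⟨ cong (_* ff w (r ∸ 1)) (length-tabulate {n = r} id) ⟩
      r * ff w (r ∸ 1)                      ∎
      where
      at : ∀ x → a x + b x ≡ r ∸ 1
      at x = trans (≡-sym (m+n∸n≡m (a x + b x) 1)) (cong (_∸ 1) (a+b x))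
    go : ∀ r′ → r ≡ r′ → ff (suc w) r ≡ ff w r + f w w
    go zero    refl = refl
    go (suc p) refl = trans (ff-suc w p) (cong (ff w (suc p) +_) (≡-sym f-diag))

  f-convex : ∀ t m → 2 * f (1 + t) m ≤ f t m + f (2 + t) m
  f-convex t m = begin
    2 * f (1 + t) m
      ≡⟨ ∑-*ˡ (allFin r) _ 2 ⟨
    ∑ (allFin r) (λ x → 2 * (ff (1 + t) (a x) * ff (m ∸ a x) (b x)))
      ≤⟨ ∑-mono (allFin r) (λ x → begin
           2 * (ff (1 + t) (a x) * ff (m ∸ a x) (b x))   ≡⟨ *-assoc 2 (ff (1 + t) (a x)) _ ⟨
           2 * ff (1 + t) (a x) * ff (m ∸ a x) (b x)     ≤⟨ *-monoˡ-≤ (ff (m ∸ a x) (b x)) (ff-convex t (a x)) ⟩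
           (ff t (a x) + ff (2 + t) (a x)) * ff (m ∸ a x) (b x) ≡⟨ *-distribʳ-+ (ff (m ∸ a x) (b x)) (ff t (a x)) (ff (2 + t) (a x)) ⟩
           ff t (a x) * ff (m ∸ a x) (b x) + ff (2 + t) (a x) * ff (m ∸ a x) (b x) ∎) ⟩
    ∑ (allFin r) (λ x → ff t (a x) * ff (m ∸ a x) (b x) + ff (2 + t) (a x) * ff (m ∸ a x) (b x))
      ≡⟨ ∑-+ (allFin r) _ _ ⟩
    f t m + f (2 + t) m ∎
    where open ≤-Reasoning

  -- Term by term this is a rearrangement inequality: as `t ≤ w`, the left side pairs the larger
  -- near factor with the smaller far factor, while the right side pairs large with large and also
  -- raises both near factors.
  f-exchange : ∀ {t w} → t ≤ w → f w w + f t (suc w) ≤ f (suc w) (suc w) + f (suc t) w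
  f-exchange {t} {w} t≤w = begin
    f w w + f t (suc w)                  ≡⟨ ∑-+ (allFin r) _ _ ⟨
    ∑ (allFin r) (λ x → ff w (a x) * ff (w ∸ a x) (b x) + ff t (a x) * ff (suc w ∸ a x) (b x))
      ≤⟨ ∑-mono (allFin r) (λ x → exchange (ff-mono (a x) (m≤n⇒m≤1+n t≤w)) (ff-mono (a x) (n≤1+n w)) (ff-mono (a x) (n≤1+n t))
                                    (ff-mono (b x) (∸-monoˡ-≤ (a x) (n≤1+n w)))) ⟩
    ∑ (allFin r) (λ x → ff (suc w) (a x) * ff (suc w ∸ a x) (b x) + ff (suc t) (a x) * ff (w ∸ a x) (b x))
      ≡⟨ ∑-+ (allFin r) _ _ ⟩
    f (suc w) (suc w) + f (suc t) w      ∎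
    where
    open ≤-Reasoning
    exchange : ∀ {p q q′ p′ c c′} → p ≤ q′ → q ≤ q′ → p ≤ p′ → c ≤ c′ →
               q * c + p * c′ ≤ q′ * c′ + p′ * c
    exchange {p} {q} {q′} {p′} {c} {c′} p≤q′ q≤q′ p≤p′ c≤c′ with m≤n⇒∃[o]m+o≡n p≤q′
    ... | k , refl = begin
      q * c + p * c′                ≤⟨ +-monoˡ-≤ (p * c′) (*-monoˡ-≤ c q≤q′) ⟩
      (p + k) * c + p * c′          ≡⟨ lem p k c c′ ⟩
      p * c′ + k * c + p * c        ≤⟨ +-mono-≤ (+-monoʳ-≤ (p * c′) (*-monoʳ-≤ k c≤c′)) (*-monoˡ-≤ c p≤p′) ⟩
      p * c′ + k * c′ + p′ * c      ≡⟨ cong (_+ p′ * c) (*-distribʳ-+ c′ p k) ⟨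
      (p + k) * c′ + p′ * c         ∎
      where
      lem : ∀ p k c c′ → (p + k) * c + p * c′ ≡ p * c′ + k * c + p * c
      lem = solve-∀

  -- All three profiles have `w + j + 2` vertices in total and are compared layer by layer. A vertex
  -- added to at least `w + 2` others is handled by `f-convex`. The lowest layers, where cliques of
  -- three sizes meet added vertices, reduce through `ff-step` to `f-exchange`.
  grow-convex : ∀ {t w} j → suc t ≤ w → 2 * grow (1 + t) (1 + w) (1 + j) ≤ grow t (2 + w) j + grow (2 + t) w (2 + j)
  grow-convex {t} {w} zero t<w = begin
    2 * (ff (1 + w) r + f (1 + t) (1 + w + 0))
      ≡⟨ cong (λ z → 2 * (ff (1 + w) r + f (1 + t) z)) (+-identityʳ (1 + w)) ⟩
    2 * (ff (1 + w) r + f (1 + t) (1 + w))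
      ≡⟨ cong (λ z → 2 * (z + f (1 + t) (1 + w))) (ff-step w) ⟩
    2 * (ff w r + f w w + f (1 + t) (1 + w))
      ≡⟨ lem₁ (ff w r) (f w w) (f (1 + t) (1 + w)) ⟩
    (ff w r + f w w) + (ff w r + (f w w + f (1 + t) (1 + w))) + f (1 + t) (1 + w)
      ≤⟨ +-mono-≤ (+-monoʳ-≤ (ff w r + f w w) (+-monoʳ-≤ (ff w r) (f-exchange t<w)))
                  (f-mono (n≤1+n (1 + t)) ≤-refl) ⟩
    (ff w r + f w w) + (ff w r + (f (1 + w) (1 + w) + f (2 + t) w)) + f (2 + t) (1 + w)
      ≡⟨ cong (λ z → z + (ff w r + (f (1 + w) (1 + w) + f (2 + t) w)) + f (2 + t) (1 + w)) (ff-step w) ⟨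
    ff (1 + w) r + (ff w r + (f (1 + w) (1 + w) + f (2 + t) w)) + f (2 + t) (1 + w)
      ≡⟨ lem₂ (ff (1 + w) r) (ff w r) (f (1 + w) (1 + w)) (f (2 + t) w) (f (2 + t) (1 + w)) ⟩
    (ff (1 + w) r + f (1 + w) (1 + w)) + (ff w r + f (2 + t) w + f (2 + t) (1 + w))
      ≡⟨ cong₂ (λ x y → x + (ff w r + f (2 + t) y + f (2 + t) (1 + w))) (ff-step (1 + w)) (+-identityʳ w) ⟨
    ff (2 + w) r + (ff w r + f (2 + t) (w + 0) + f (2 + t) (1 + w))
      ≡⟨ cong (λ y → ff (2 + w) r + (ff w r + f (2 + t) (w + 0) + f (2 + t) y)) (+-comm w 1) ⟨
    ff (2 + w) r + (ff w r + f (2 + t) (w + 0) + f (2 + t) (w + 1)) ∎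
    where
    open ≤-Reasoning
    lem₁ : ∀ x y z → 2 * (x + y + z) ≡ (x + y) + (x + (y + z)) + z
    lem₁ = solve-∀
    lem₂ : ∀ x y z u v → x + (y + (z + u)) + v ≡ (x + z) + (y + u + v)
    lem₂ = solve-∀
  grow-convex {t} {w} (suc j) t<w = begin
    2 * (grow (1 + t) (1 + w) (1 + j) + f (1 + t) (1 + w + suc j))
      ≡⟨ *-distribˡ-+ 2 (grow (1 + t) (1 + w) (1 + j)) _ ⟩
    2 * grow (1 + t) (1 + w) (1 + j) + 2 * f (1 + t) (1 + w + suc j)
      ≤⟨ +-mono-≤ (grow-convex j t<w) (f-convex t (1 + w + suc j)) ⟩
    (grow t (2 + w) j + grow (2 + t) w (2 + j)) + (f t (1 + w + suc j) + f (2 + t) (1 + w + suc j))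
      ≡⟨ interchange (grow t (2 + w) j) (grow (2 + t) w (2 + j)) (f t (1 + w + suc j)) _ ⟩
    (grow t (2 + w) j + f t (1 + w + suc j)) + (grow (2 + t) w (2 + j) + f (2 + t) (1 + w + suc j))
      ≡⟨ cong₂ (λ y z → (grow t (2 + w) j + f t y) + (grow (2 + t) w (2 + j) + f (2 + t) z))
               (cong suc (+-suc w j)) (≡-sym (+-suc w (suc j))) ⟩
    (grow t (2 + w) j + f t (2 + w + j)) + (grow (2 + t) w (2 + j) + f (2 + t) (w + (2 + j))) ∎
    where
    open ≤-Reasoning
    interchange : ∀ x y z u → (x + y) + (z + u) ≡ (x + z) + (y + u)
    interchange = solve-∀

-- The step from `t` to `suc t` decides which end wins: convexity carries a rise on to `c` and a
-- fall back to `k`.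
convex⇒≤ends : ∀ (F : ℕ → ℕ) c → (∀ t → 2 + t ≤ c → 2 * F (1 + t) ≤ F t + F (2 + t)) →
               ∀ {k t} → k ≤ t → t ≤ c → F t ≤ F k ⊔ F c
convex⇒≤ends F c convex {k} {t} k≤t t≤c with m≤n⇒m<n∨m≡n t≤c
... | inj₂ refl = m≤n⊔m (F k) (F t)
... | inj₁ t<c with ≤-total (F t) (F (suc t))
...   | inj₁ rise = ≤-trans (subst (λ z → F t ≤ F z) (m+[n∸m]≡n t<c) (up t (c ∸ suc t) (≤-reflexive (m+[n∸m]≡n t<c)) rise)) (m≤n⊔m (F k) (F c))
  where
  up : ∀ t j → suc t + j ≤ c → F t ≤ F (suc t) → F t ≤ F (suc t + j)
  up t zero    _  h = subst (λ z → F t ≤ F z) (≡-sym (+-identityʳ (suc t))) h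
  up t (suc j) le h = ≤-trans h (subst (λ z → F (suc t) ≤ F z) (≡-sym (+-suc (suc t) j))
    (up (suc t) j (subst (_≤ c) (+-suc (suc t) j) le) h′))
    where
    h′ : F (suc t) ≤ F (2 + t)
    h′ = +-cancelˡ-≤ (F (suc t)) _ _ (begin
      F (suc t) + F (suc t) ≡⟨ cong (F (suc t) +_) (+-identityʳ (F (suc t))) ⟨
      2 * F (1 + t)         ≤⟨ convex t (≤-trans (s≤s (s≤s (m≤m+n t j))) (subst (_≤ c) (+-suc (suc t) j) le)) ⟩
      F t + F (2 + t)       ≤⟨ +-monoˡ-≤ _ h ⟩
      F (suc t) + F (2 + t) ∎)
      where open ≤-Reasoning
...   | inj₂ fall = ≤-trans (subst (λ z → F z ≤ F k) (m+[n∸m]≡n k≤t)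
          (down (t ∸ k) (subst (_< c) (≡-sym (m+[n∸m]≡n k≤t)) t<c)
                (subst (λ z → F (suc z) ≤ F z) (≡-sym (m+[n∸m]≡n k≤t)) fall))) (m≤m⊔n (F k) (F c))
  where
  down : ∀ j → k + j < c → F (suc (k + j)) ≤ F (k + j) → F (k + j) ≤ F k
  down zero    _  _ = ≤-reflexive (cong F (+-identityʳ k))
  down (suc j) lt h rewrite +-suc k j = ≤-trans h′ (down j (<-trans (n<1+n _) lt) h′)
    where
    h′ : F (suc (k + j)) ≤ F (k + j)
    h′ = +-cancelʳ-≤ (F (suc (k + j))) _ _ (begin
      F (suc (k + j)) + F (suc (k + j)) ≡⟨ cong (F (suc (k + j)) +_) (+-identityʳ _) ⟨
      2 * F (suc (k + j))               ≤⟨ convex (k + j) lt ⟩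
      F (k + j) + F (2 + (k + j))       ≤⟨ +-monoʳ-≤ (F (k + j)) h ⟩
      F (k + j) + F (suc (k + j))       ∎)
      where open ≤-Reasoning

-- Counting injections with prescribed roles

∧-true : ∀ {x y} → x ∧ y ≡ true → x ≡ true × y ≡ true
∧-true {true} {true} _ = refl , refl

∧-intro : ∀ {x y} → x ≡ true → y ≡ true → x ∧ y ≡ true
∧-intro refl refl = refl

true≢false : ∀ {x} → x ≡ true → x ≡ false → ⊥
true≢false refl ()

does-true : (P? : Dec P) → does P? ≡ true → P
does-true (yes p) _ = p

VSet : ℕ → Set
VSet n = Fin n → Bool

_⊆_ : VSet n → VSet n → Set
S ⊆ W = ∀ v → S v ≡ true → W v ≡ true

size : VSet n → ℕ
size {n} W = countB W (allFin n)

minus : VSet n → Fin n → VSet n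
minus W v u = W u ∧ not (does (v ≟ᶠ u))

full : VSet n
full _ = true

size-mono : {S W : VSet n} → S ⊆ W → size S ≤ size W
size-mono {n} S⊆W = ∑-mono (allFin n) (λ v → ⟦⟧-mono (S⊆W v))

size-full : size (full {n}) ≡ n
size-full {n} = trans (∑-const (allFin n) 1)
  (trans (*-identityʳ _) (length-tabulate {n = n} id))

minus-sound : ∀ (W : VSet n) v {u} → minus W v u ≡ true → W u ≡ true × v ≢ u
minus-sound W v {u} h with v ≟ᶠ u
... | no v≢u = proj₁ (∧-true h) , v≢u
... | yes _  with () ← proj₂ (∧-true {W u} h)

minus-complete : ∀ (W : VSet n) {v u} → W u ≡ true → v ≢ u → minus W v u ≡ true
minus-complete W {v} {u} Wu v≢u = ∧-intro Wu (cong not (dec-false (v ≟ᶠ u) v≢u))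

size-minus : ∀ (W : VSet n) v → size W ≡ size (minus W v) + ⟦ W v ⟧
size-minus {n} W v = begin
  size W                                               ≡⟨ ∑-cong (allFin n) at ⟩
  ∑ (allFin n) (λ u → ⟦ minus W v u ⟧ + 𝟙 (v ≟ᶠ u) * ⟦ W u ⟧) ≡⟨ ∑-+ (allFin n) _ _ ⟩
  size (minus W v) + ∑ (allFin n) (λ u → 𝟙 (v ≟ᶠ u) * ⟦ W u ⟧) ≡⟨ cong (size (minus W v) +_) (∑Fin-δ v (λ u → ⟦ W u ⟧)) ⟩
  size (minus W v) + ⟦ W v ⟧                           ∎
  where
  open ≡-Reasoning
  at : ∀ u → ⟦ W u ⟧ ≡ ⟦ minus W v u ⟧ + 𝟙 (v ≟ᶠ u) * ⟦ W u ⟧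
  at u with does (v ≟ᶠ u) | W u
  ... | true  | true  = refl
  ... | true  | false = refl
  ... | false | true  = refl
  ... | false | false = refl

size-minus-∈ : ∀ (W : VSet n) v → W v ≡ true → size W ≡ suc (size (minus W v))
size-minus-∈ W v Wv = trans (size-minus W v) (trans (cong (λ z → size (minus W v) + ⟦ z ⟧) Wv) (+-comm _ 1))

size-minus-∉ : ∀ (W : VSet n) v → W v ≡ false → size (minus W v) ≡ size W
size-minus-∉ W v Wv = ≡-sym (trans (size-minus W v) (trans (cong (λ z → size (minus W v) + ⟦ z ⟧) Wv) (+-identityʳ _)))

size-minus-∈′ : ∀ (W : VSet n) v → W v ≡ true → size (minus W v) ≡ size W ∸ 1
size-minus-∈′ W v Wv = ≡-sym (cong (_∸ 1) (size-minus-∈ W v Wv))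

-- When an index x of H is sent to a vertex v, x itself has role self, its neighbours in H are near,
-- and the indices not adjacent to x are far.
data Role : Set where
  near far self : Role

is : Role → Role → Bool
is near near = true
is far  far  = true
is self self = true
is _    _    = false

number : Role → (Fin m → Role) → ℕ
number {zero}  ρ τ = 0
number {suc m} ρ τ = ⟦ is ρ (τ zero) ⟧ + number ρ (τ ∘ suc)

number-∑ : ∀ ρ (τ : Fin m → Role) → number ρ τ ≡ ∑ (allFin m) (λ i → ⟦ is ρ (τ i) ⟧)
number-∑ {zero}  ρ τ = refl
number-∑ {suc m} ρ τ = trans (cong (⟦ is ρ (τ zero) ⟧ +_) (number-∑ ρ (τ ∘ suc)))
                             (≡-sym (∑-allFin-suc {m} (λ i → ⟦ is ρ (τ i) ⟧)))

number-total : (τ : Fin m → Role) → number near τ + number far τ + number self τ ≡ m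
number-total {zero}  τ = refl
number-total {suc m} τ with τ zero | number-total (τ ∘ suc)
... | near | eq = cong suc eq
... | far  | eq = trans (cong (_+ number self (τ ∘ suc)) (+-suc (number near (τ ∘ suc)) _)) (cong suc eq)
... | self | eq = trans (+-suc _ (number self (τ ∘ suc))) (cong suc eq)

-- Each placed vertex is struck from the slots of all roles, so injectivity is built in and the
-- number of choices for the next index is always the size of a slot.
fits : (Role → VSet n) → (Fin m → Role) → Vec (Fin n) m → Bool
fits S τ []       = true
fits S τ (w ∷ ws) = S (τ zero) w ∧ fits (λ ρ → minus (S ρ) w) (τ ∘ suc) ws

Injective : Vec (Fin n) m → Set
Injective φ = ∀ i j → lookup φ i ≡ lookup φ j → i ≡ j

fits-sound : ∀ (S : Role → VSet n) (τ : Fin m → Role) φ → fits S τ φ ≡ true →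
             (∀ i → S (τ i) (lookup φ i) ≡ true) × Injective φ
fits-sound S τ []       _ = (λ ()) , λ ()
fits-sound S τ (w ∷ ws) h with ∧-true {S (τ zero) w} h
... | h₀ , h₁ with fits-sound (λ ρ → minus (S ρ) w) (τ ∘ suc) ws h₁
...   | mem , inj = mem′ , inj′
  where
  mem′ : ∀ i → S (τ i) (lookup (w ∷ ws) i) ≡ true
  mem′ zero    = h₀
  mem′ (suc i) = proj₁ (minus-sound (S (τ (suc i))) w (mem i))
  new : ∀ i → w ≢ lookup ws i
  new i = proj₂ (minus-sound (S (τ (suc i))) w (mem i))
  inj′ : Injective (w ∷ ws)
  inj′ zero    zero    _  = refl
  inj′ zero    (suc j) eq = ⊥-elim (new j eq)
  inj′ (suc i) zero    eq = ⊥-elim (new i (≡-sym eq))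
  inj′ (suc i) (suc j) eq = cong suc (inj i j eq)

fits-complete : ∀ (S : Role → VSet n) (τ : Fin m → Role) φ →
                (∀ i → S (τ i) (lookup φ i) ≡ true) → Injective φ → fits S τ φ ≡ true
fits-complete S τ []       _   _   = refl
fits-complete S τ (w ∷ ws) mem inj = ∧-intro (mem zero)
  (fits-complete _ (τ ∘ suc) ws
    (λ i → minus-complete (S (τ (suc i))) (mem (suc i)) (λ eq → Finₚ.0≢1+n (inj zero (suc i) eq)))
    (λ i j eq → Finₚ.suc-injective (inj (suc i) (suc j) eq)))

∑-weighted : ∀ (W : VSet n) (F : Fin n → ℕ) c → (∀ w → W w ≡ true → F w ≡ c) →
             ∑ (allFin n) (λ w → ⟦ W w ⟧ * F w) ≡ size W * c
∑-weighted {n} W F c h = trans (∑-cong (allFin n) at) (∑-*ʳ (allFin n) (λ w → ⟦ W w ⟧) c)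
  where
  at : ∀ w → ⟦ W w ⟧ * F w ≡ ⟦ W w ⟧ * c
  at w with W w in eq
  ... | true  = cong (1 *_) (h w eq)
  ... | false = refl

module _ {n : ℕ} where
  private
    expected : (Role → VSet n) → (Fin m → Role) → ℕ
    expected S τ = ff (size (S near)) (number near τ)
                 * ff (size (S far) ∸ number near τ) (number far τ)
                 * ff (size (S self)) (number self τ)

  -- The indices are placed one at a time; the product does not depend on the order in which the roles occur.
  count-fits : ∀ {m} (S : Role → VSet n) (τ : Fin m → Role) →
               S near ⊆ S far → (∀ v → S far v ≡ true → S self v ≡ false) →
               ∑ (vecsOver (allFin n) m) (λ φ → ⟦ fits S τ φ ⟧) ≡ expected S τ
  count-fits {zero}  S τ _   _    = refl
  count-fits {suc m} S τ sub disj = begin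
    ∑ (vecsOver (allFin n) (suc m)) (λ φ → ⟦ fits S τ φ ⟧)
      ≡⟨ ∑-vecsOver (allFin n) m _ ⟩
    ∑ (allFin n) (λ w → ∑ (vecsOver (allFin n) m) (λ φ → ⟦ S (τ zero) w ∧ fits (λ ρ → minus (S ρ) w) (τ ∘ suc) φ ⟧))
      ≡⟨ ∑-cong (allFin n) (λ w → trans
           (∑-cong (vecsOver (allFin n) m) (λ φ → ⟦∧⟧ (S (τ zero) w) _))
           (trans (∑-*ˡ (vecsOver (allFin n) m) _ ⟦ S (τ zero) w ⟧)
                  (cong (⟦ S (τ zero) w ⟧ *_) (count-fits (λ ρ → minus (S ρ) w) (τ ∘ suc) (sub′ w) (disj′ w))))) ⟩
    ∑ (allFin n) (λ w → ⟦ S (τ zero) w ⟧ * expected (λ ρ → minus (S ρ) w) (τ ∘ suc))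
      ≡⟨ step ⟩
    expected S τ ∎
    where
    open ≡-Reasoning
    T = S near
    U = S far
    Z = S self
    t = size T
    u = size U
    z = size Z
    a = number near (τ ∘ suc)
    b = number far (τ ∘ suc)
    c = number self (τ ∘ suc)

    sub′ : ∀ w → minus T w ⊆ minus U w
    sub′ w v h with minus-sound T w h
    ... | Tv , w≢v = minus-complete U (sub v Tv) w≢v

    disj′ : ∀ w v → minus U w v ≡ true → minus Z w v ≡ false
    disj′ w v h rewrite disj v (proj₁ (minus-sound U w h)) = refl

    Z⇒∉U : ∀ w → Z w ≡ true → U w ≡ false
    Z⇒∉U w Zw with U w in eq
    ... | true  = ⊥-elim (true≢false Zw (disj w eq))
    ... | false = refl

    ∉U⇒∉T : ∀ w → U w ≡ false → T w ≡ false
    ∉U⇒∉T w Uw with T w in eq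
    ... | true  = ⊥-elim (true≢false (sub w eq) Uw)
    ... | false = refl

    -- The number of ways to place the remaining indices once a vertex of `T` is used up (`c₁`), or
    -- a vertex of `U` outside `T` (`c₂`).
    c₁ = ff (t ∸ 1) a * ff ((u ∸ 1) ∸ a) b * ff z c
    c₂ = ff t a * ff ((u ∸ 1) ∸ a) b * ff z c

    F : Fin n → ℕ
    F w = expected (λ ρ → minus (S ρ) w) (τ ∘ suc)

    F-near : ∀ w → T w ≡ true → F w ≡ c₁
    F-near w Tw rewrite size-minus-∈′ T w Tw | size-minus-∈′ U w (sub w Tw)
                      | size-minus-∉ Z w (disj w (sub w Tw)) = refl

    U∖T : VSet n
    U∖T w = U w ∧ not (T w)

    F-far : ∀ w → U∖T w ≡ true → F w ≡ c₂
    F-far w h with ∧-true {U w} h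
    ... | Uw , ¬Tw with T w in Tw
    ...   | false rewrite size-minus-∉ T w Tw | size-minus-∈′ U w Uw | size-minus-∉ Z w (disj w Uw) = refl

    F-self : ∀ w → Z w ≡ true → F w ≡ ff t a * ff (u ∸ a) b * ff (z ∸ 1) c
    F-self w Zw rewrite size-minus-∉ T w (∉U⇒∉T w (Z⇒∉U w Zw)) | size-minus-∉ U w (Z⇒∉U w Zw)
                      | size-minus-∈′ Z w Zw = refl

    U-split : ∀ w → ⟦ U w ⟧ ≡ ⟦ T w ⟧ + ⟦ U∖T w ⟧
    U-split w with T w in Tw | U w in Uw
    ... | true  | true  = refl
    ... | true  | false = ⊥-elim (true≢false (sub w Tw) Uw)
    ... | false | true  = refl
    ... | false | false = refl

    size-U∖T : size U∖T ≡ u ∸ t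
    size-U∖T = ≡-sym (trans (cong (_∸ t) (trans (∑-cong (allFin n) U-split) (∑-+ (allFin n) _ _)))
                            (m+n∸m≡n t (size U∖T)))

    pred-∸ : ∀ u a → (u ∸ 1) ∸ a ≡ (u ∸ a) ∸ 1
    pred-∸ u a = trans (∸-+-assoc u 1 a) (trans (cong (u ∸_) (+-comm 1 a)) (≡-sym (∸-+-assoc u a 1)))

    assoc-out : ∀ t x y z → t * (x * y * z) ≡ (t * x) * y * z
    assoc-out = solve-∀
    assoc-out₃ : ∀ t x y z → t * (x * y * z) ≡ x * y * (t * z)
    assoc-out₃ = solve-∀
    collect : ∀ t v x x′ y z → t * (x * y * z) + v * (x′ * y * z) ≡ (t * x + v * x′) * y * z
    collect = solve-∀
    regroup : ∀ x y z w → x * y * z * w ≡ y * (x * z) * w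
    regroup = solve-∀

    step : ∑ (allFin n) (λ w → ⟦ S (τ zero) w ⟧ * F w) ≡ expected S τ
    step with τ zero
    ... | near = begin
      ∑ (allFin n) (λ w → ⟦ T w ⟧ * F w)             ≡⟨ ∑-weighted T F c₁ F-near ⟩
      t * c₁                                         ≡⟨ assoc-out t _ _ _ ⟩
      t * ff (t ∸ 1) a * ff ((u ∸ 1) ∸ a) b * ff z c ≡⟨ cong₂ (λ x y → x * ff y b * ff z c) (ff-head t a) (∸-+-assoc u 1 a) ⟩
      ff t (suc a) * ff (u ∸ suc a) b * ff z c       ∎
    -- A far index may occupy a vertex of `T` and so take a choice away from the near ones, hence
    -- the split of `U`. By `ff-pick` the total is as if the near indices had been placed first.
    ... | far = begin
      ∑ (allFin n) (λ w → ⟦ U w ⟧ * F w)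
        ≡⟨ ∑-cong (allFin n) (λ w → trans (cong (_* F w) (U-split w)) (*-distribʳ-+ (F w) ⟦ T w ⟧ _)) ⟩
      ∑ (allFin n) (λ w → ⟦ T w ⟧ * F w + ⟦ U∖T w ⟧ * F w)
        ≡⟨ ∑-+ (allFin n) _ _ ⟩
      ∑ (allFin n) (λ w → ⟦ T w ⟧ * F w) + ∑ (allFin n) (λ w → ⟦ U∖T w ⟧ * F w)
        ≡⟨ cong₂ _+_ (∑-weighted T F c₁ F-near) (∑-weighted U∖T F c₂ F-far) ⟩
      t * c₁ + size U∖T * c₂
        ≡⟨ collect t (size U∖T) (ff (t ∸ 1) a) (ff t a) (ff ((u ∸ 1) ∸ a) b) (ff z c) ⟩
      (t * ff (t ∸ 1) a + size U∖T * ff t a) * ff ((u ∸ 1) ∸ a) b * ff z c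
        ≡⟨ cong₂ (λ x y → (x + y * ff t a) * ff ((u ∸ 1) ∸ a) b * ff z c) (ff-head t a) size-U∖T ⟩
      (ff t (suc a) + (u ∸ t) * ff t a) * ff ((u ∸ 1) ∸ a) b * ff z c
        ≡⟨ cong₂ (λ x y → x * ff y b * ff z c) (ff-pick a (size-mono sub)) (pred-∸ u a) ⟩
      (u ∸ a) * ff t a * ff ((u ∸ a) ∸ 1) b * ff z c
        ≡⟨ regroup (u ∸ a) (ff t a) (ff ((u ∸ a) ∸ 1) b) (ff z c) ⟩
      ff t a * ((u ∸ a) * ff ((u ∸ a) ∸ 1) b) * ff z c
        ≡⟨ cong (λ x → ff t a * x * ff z c) (ff-head (u ∸ a) b) ⟩
      ff t a * ff (u ∸ a) (suc b) * ff z c ∎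
    ... | self = begin
      ∑ (allFin n) (λ w → ⟦ Z w ⟧ * F w)             ≡⟨ ∑-weighted Z F _ F-self ⟩
      z * (ff t a * ff (u ∸ a) b * ff (z ∸ 1) c)     ≡⟨ assoc-out₃ z (ff t a) (ff (u ∸ a) b) _ ⟩
      ff t a * ff (u ∸ a) b * (z * ff (z ∸ 1) c)     ≡⟨ cong (ff t a * ff (u ∸ a) b *_) (ff-head z c) ⟩
      ff t a * ff (u ∸ a) b * ff z (suc c)           ∎

-- Embeddings under removal and addition of a vertex

module Embeddings {r n : ℕ} (H : SimpleGraph r) (G : SimpleGraph n) where

  -- Non-edges of `H` may be sent to edges, because copies are subgraphs and need not be induced.
  Emb : VSet n → Vec (Fin n) r → Set
  Emb W φ = (∀ i → W (lookup φ i) ≡ true) × Injective φ ×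
            (∀ i j → adj H i j ≡ true → adj G (lookup φ i) (lookup φ j) ≡ true)

  emb? : ∀ W φ → Dec (Emb W φ)
  emb? W φ = all? (λ i → W (lookup φ i) ≟ᵇ true)
       ×-dec all? (λ i → all? λ j → (lookup φ i ≟ᶠ lookup φ j) →-dec (i ≟ᶠ j))
       ×-dec all? (λ i → all? λ j → (adj H i j ≟ᵇ true) →-dec (adj G (lookup φ i) (lookup φ j) ≟ᵇ true))

  embs : VSet n → ℕ
  embs W = ∑ (vecsOver (allFin n) r) (λ φ → 𝟙 (emb? W φ))

module Roles {r : ℕ} (H : SimpleGraph r) where

  -- Equality is tested first; by irreflexivity `x` would otherwise be far from itself.
  role : Fin r → Fin r → Role
  role x i = if does (x ≟ᶠ i) then self else if adj H x i then near else far

  role-self : ∀ x → role x x ≡ self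
  role-self x rewrite dec-true (x ≟ᶠ x) refl = refl

  role-near : ∀ x i → adj H x i ≡ true → role x i ≡ near
  role-near x i h with x ≟ᶠ i
  ... | yes refl = ⊥-elim (true≢false h (irrefl H x))
  ... | no _ rewrite h = refl

  number-self : ∀ x → number self (role x) ≡ 1
  number-self x = trans (number-∑ self (role x)) (trans (∑-cong (allFin r) at) (Finite.once (finiteFin r) x))
    where
    at : ∀ i → ⟦ is self (role x i) ⟧ ≡ 𝟙 (x ≟ᶠ i)
    at i with does (x ≟ᶠ i) | adj H x i
    ... | true  | _     = refl
    ... | false | true  = refl
    ... | false | false = refl

  open Extremal r (λ x → number near (role x)) (λ x → number far (role x))
    (λ x → trans (cong (number near (role x) + number far (role x) +_) (≡-sym (number-self x)))
                 (number-total (role x))) public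

  slots : VSet n → VSet n → Fin n → Role → VSet n
  slots T U v near = T
  slots T U v far  = U
  slots T U v self = λ u → does (v ≟ᶠ u)

  count-slots : ∀ (T U : VSet n) v → T ⊆ U → U v ≡ false →
                ∑ (vecsOver (allFin n) r) (λ φ → ∑ (allFin r) (λ x → ⟦ fits (slots T U v) (role x) φ ⟧))
                ≡ f (size T) (size U)
  count-slots {n} T U v T⊆U v∉U = begin
    ∑ (vecsOver (allFin n) r) (λ φ → ∑ (allFin r) (λ x → ⟦ fits (slots T U v) (role x) φ ⟧))
      ≡⟨ ∑-swap (vecsOver (allFin n) r) (allFin r) _ ⟩
    ∑ (allFin r) (λ x → ∑ (vecsOver (allFin n) r) (λ φ → ⟦ fits (slots T U v) (role x) φ ⟧))
      ≡⟨ ∑-cong (allFin r) (λ x → trans (count-fits (slots T U v) (role x) T⊆U disj) (at x)) ⟩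
    f (size T) (size U) ∎
    where
    open ≡-Reasoning
    disj : ∀ u → U u ≡ true → does (v ≟ᶠ u) ≡ false
    disj u Uu = dec-false (v ≟ᶠ u) (λ { refl → true≢false Uu v∉U })
    at : ∀ x → let a = number near (role x); b = number far (role x) in
         ff (size T) a * ff (size U ∸ a) b * ff (∑ (allFin n) (λ u → 𝟙 (v ≟ᶠ u))) (number self (role x))
         ≡ ff (size T) a * ff (size U ∸ a) b
    at x rewrite number-self x | Finite.once (finiteFin n) v = *-identityʳ _

module Removal {r n : ℕ} (H : SimpleGraph r) (G : SimpleGraph n) where
  open Embeddings H G
  open Roles H

  -- With every index far and the other slots empty, `fits` only asks for an injection into `W`, and
  -- `count-fits` degenerates to a single falling factorial.
  everything : Role → VSet n → VSet n
  everything near W = λ _ → false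
  everything far  W = W
  everything self W = λ _ → false

  count-free : ∀ W → ∑ (vecsOver (allFin n) r) (λ φ → ⟦ fits (λ ρ → everything ρ W) (λ _ → far) φ ⟧) ≡ ff (size W) r
  count-free W = trans (count-fits {m = r} (λ ρ → everything ρ W) (λ _ → far) (λ _ ()) (λ _ _ → refl)) at
    where
    number-const : ∀ m → (number {m} near (λ _ → far) ≡ 0) × (number {m} far (λ _ → far) ≡ m) × (number {m} self (λ _ → far) ≡ 0)
    number-const zero    = refl , refl , refl
    number-const (suc m) with number-const m
    ... | p , q , s = p , cong suc q , s
    at : ff (size {n} (λ _ → false)) (number {r} near (λ _ → far))
       * ff (size W ∸ number {r} near (λ _ → far)) (number {r} far (λ _ → far))
       * ff (size {n} (λ _ → false)) (number {r} self (λ _ → far)) ≡ ff (size W) r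
    at with number-const r
    ... | p , q , s rewrite p | q | s = trans (*-identityʳ _) (+-identityʳ _)

  embs-≤-ff : ∀ W → embs W ≤ ff (size W) r
  embs-≤-ff W = ≤-trans (∑-mono (vecsOver (allFin n) r) at) (≤-reflexive (count-free W))
    where
    at : ∀ φ → 𝟙 (emb? W φ) ≤ ⟦ fits (λ ρ → everything ρ W) (λ _ → far) φ ⟧
    at φ = 𝟙≤ (emb? W φ) λ (mem , inj , _) →
      ≤-reflexive (≡-sym (cong ⟦_⟧ (fits-complete _ (λ _ → far) φ mem inj)))

  ff-≤-embs : ∀ W → (∀ u v → W u ≡ true → W v ≡ true → u ≢ v → adj G u v ≡ true) → ff (size W) r ≤ embs W
  ff-≤-embs W clique = ≤-trans (≤-reflexive (≡-sym (count-free W))) (∑-mono (vecsOver (allFin n) r) at)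
    where
    at : ∀ φ → ⟦ fits (λ ρ → everything ρ W) (λ _ → far) φ ⟧ ≤ 𝟙 (emb? W φ)
    at φ = ⟦⟧-mono λ h → let mem , inj = fits-sound _ (λ _ → far) φ h in
      dec-true (emb? W φ) (mem , inj , λ i j hij →
        clique _ _ (mem i) (mem j) (λ eq → true≢false hij (subst (λ k → adj H i k ≡ false) (inj i j eq) (irrefl H i))))

  degIn : VSet n → Fin n → ℕ
  degIn W v = size (λ u → W u ∧ adj G v u)

  degIn-mono : ∀ {S W} → S ⊆ W → ∀ v → degIn S v ≤ degIn W v
  degIn-mono {S} S⊆W v = size-mono (λ u h → ∧-intro (S⊆W u (proj₁ (∧-true {S u} h))) (proj₂ (∧-true {S u} h)))

  degIn≤degree : ∀ W v → degIn W v ≤ degree G v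
  degIn≤degree W v = size-mono {W = adj G v} (λ u h → proj₂ (∧-true {W u} h))

  -- An embedding into `W` avoids `v` or sends some `x` to it. In the second case the neighbours of
  -- `x` land among the neighbours of `v` in `W`, and the other indices elsewhere in `W`. The edges
  -- not at `v` are forgotten, hence only an upper bound.
  embs-remove : ∀ W v → W v ≡ true → embs W ≤ embs (minus W v) + f (degIn W v) (size (minus W v))
  embs-remove W v Wv = begin
    embs W
      ≤⟨ ∑-mono (vecsOver (allFin n) r) at ⟩
    ∑ (vecsOver (allFin n) r) (λ φ → 𝟙 (emb? (minus W v) φ) + ∑ (allFin r) (λ x → ⟦ fits S (role x) φ ⟧))
      ≡⟨ ∑-+ (vecsOver (allFin n) r) _ _ ⟩
    embs (minus W v) + ∑ (vecsOver (allFin n) r) (λ φ → ∑ (allFin r) (λ x → ⟦ fits S (role x) φ ⟧))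
      ≡⟨ cong (embs (minus W v) +_) (count-slots T (minus W v) v T⊆U v∉U) ⟩
    embs (minus W v) + f (degIn W v) (size (minus W v)) ∎
    where
    open ≤-Reasoning
    T : VSet n
    T u = W u ∧ adj G v u
    S = slots T (minus W v) v
    T⊆U : T ⊆ minus W v
    T⊆U u h with ∧-true {W u} h
    ... | Wu , vu = minus-complete W {v} Wu (λ { refl → true≢false vu (irrefl G v) })
    v∉U : minus W v v ≡ false
    v∉U rewrite Wv | dec-true (v ≟ᶠ v) refl = refl
    at : ∀ φ → 𝟙 (emb? W φ) ≤ 𝟙 (emb? (minus W v) φ) + ∑ (allFin r) (λ x → ⟦ fits S (role x) φ ⟧)
    at φ = 𝟙≤ (emb? W φ) split
      where
      split : Emb W φ → 1 ≤ 𝟙 (emb? (minus W v) φ) + ∑ (allFin r) (λ x → ⟦ fits S (role x) φ ⟧)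
      split (mem , inj , hom) with any? (λ x → v ≟ᶠ lookup φ x)
      ... | no avoid = ≤-trans (≤-reflexive (≡-sym (𝟙-true (emb? (minus W v) φ)
              ((λ i → minus-complete W (mem i) (λ eq → avoid (i , eq))) , inj , hom)))) (m≤m+n _ _)
      ... | yes (x , refl) = ≤-trans (≤-trans (≤-reflexive (≡-sym (cong ⟦_⟧ (fits-complete S (role x) φ mem′ inj))))
              (∑Fin-lower (λ x → ⟦ fits S (role x) φ ⟧) x)) (m≤n+m _ _)
        where
        mem′ : ∀ i → S (role x i) (lookup φ i) ≡ true
        mem′ i with x ≟ᶠ i | adj H x i in eq
        ... | yes refl | _     = dec-true (lookup φ x ≟ᶠ lookup φ x) refl
        ... | no _     | true  = ∧-intro (mem i) (hom x i eq)
        ... | no x≢i   | false = minus-complete W {lookup φ x} (mem i) (λ e → x≢i (inj x i e))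

  -- Adjacent indices are not both far from x in a complete multipartite H, so one of them lands in T.
  embs-add : (∀ x y z → adj H x y ≡ false → adj H x z ≡ false → adj H y z ≡ false) →
             ∀ W U T v → W v ≡ true → U ⊆ W → U v ≡ false → T ⊆ U →
             (∀ u w → T u ≡ true → u ≢ w → adj G u w ≡ true) →
             embs U + f (size T) (size U) ≤ embs W
  embs-add multipartite W U T v Wv U⊆W v∉U T⊆U dominating = begin
    embs U + f (size T) (size U)
      ≡⟨ cong (embs U +_) (count-slots T U v T⊆U v∉U) ⟨
    embs U + ∑ (vecsOver (allFin n) r) (λ φ → ∑ (allFin r) (λ x → ⟦ fits S (role x) φ ⟧))
      ≡⟨ ∑-+ (vecsOver (allFin n) r) _ _ ⟨
    ∑ (vecsOver (allFin n) r) (λ φ → 𝟙 (emb? U φ) + ∑ (allFin r) (λ x → ⟦ fits S (role x) φ ⟧))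
      ≤⟨ ∑-mono (vecsOver (allFin n) r) at ⟩
    embs W ∎
    where
    open ≤-Reasoning
    S = slots T U v

    at-self : ∀ φ x → fits S (role x) φ ≡ true → v ≡ lookup φ x
    at-self φ x h = does-true (v ≟ᶠ lookup φ x)
      (subst (λ ρ → S ρ (lookup φ x) ≡ true) (role-self x) (proj₁ (fits-sound S (role x) φ h) x))

    fits⇒emb : ∀ φ x → fits S (role x) φ ≡ true → Emb W φ
    fits⇒emb φ x h = mem′ , inj , hom
      where
      mem = proj₁ (fits-sound S (role x) φ h)
      inj = proj₂ (fits-sound S (role x) φ h)
      mem′ : ∀ i → W (lookup φ i) ≡ true
      mem′ i with x ≟ᶠ i | adj H x i | mem i
      ... | yes refl | _     | m = subst (λ z → W z ≡ true) (at-self φ x h) Wv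
      ... | no _     | true  | m = U⊆W _ (T⊆U _ m)
      ... | no _     | false | m = U⊆W _ m
      distinct : ∀ i j → adj H i j ≡ true → lookup φ i ≢ lookup φ j
      distinct i j hij eq = true≢false hij (subst (λ k → adj H i k ≡ false) (inj i j eq) (irrefl H i))
      inT : ∀ i → adj H x i ≡ true → T (lookup φ i) ≡ true
      inT i xi = subst (λ ρ → S ρ (lookup φ i) ≡ true) (role-near x i xi) (mem i)
      hom : ∀ i j → adj H i j ≡ true → adj G (lookup φ i) (lookup φ j) ≡ true
      hom i j hij with adj H x i in xi | adj H x j in xj
      ... | true  | _     = dominating _ _ (inT i xi) (distinct i j hij)
      ... | false | true  = trans (SimpleGraph.sym G _ _)
                              (dominating _ _ (inT j xj) (λ eq → distinct i j hij (≡-sym eq)))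
      ... | false | false = ⊥-elim (true≢false hij (multipartite x i j xi xj))

    at : ∀ φ → 𝟙 (emb? U φ) + ∑ (allFin r) (λ x → ⟦ fits S (role x) φ ⟧) ≤ 𝟙 (emb? W φ)
    -- No map is counted twice: a map fitting for `x` takes the value `v` at `x`, so it leaves `U`,
    -- and by injectivity it takes this value at no other index.
    at φ with any? (λ x → fits S (role x) φ ≟ᵇ true)
    ... | yes (x , h) = ≤-reflexive (begin-equality
          𝟙 (emb? U φ) + ∑ (allFin r) (λ y → ⟦ fits S (role y) φ ⟧)
            ≡⟨ cong (_+ ∑ (allFin r) (λ y → ⟦ fits S (role y) φ ⟧)) (𝟙-false (emb? U φ)
                 (λ e → true≢false (subst (λ z → U z ≡ true) (≡-sym (at-self φ x h)) (proj₁ e x)) v∉U)) ⟩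
          ∑ (allFin r) (λ y → ⟦ fits S (role y) φ ⟧)
            ≡⟨ ∑-cong (allFin r) (λ y → bool-𝟙 (fits S (role y) φ)) ⟩
          ∑ (allFin r) (λ y → 𝟙 (fits S (role y) φ ≟ᵇ true))
            ≡⟨ ∑Fin-unique (λ y → fits S (role y) φ ≟ᵇ true) x h
                 (λ y h′ → proj₂ (fits-sound S (role x) φ h) x y (trans (≡-sym (at-self φ x h)) (at-self φ y h′))) ⟩
          1
            ≡⟨ 𝟙-true (emb? W φ) (fits⇒emb φ x h) ⟨
          𝟙 (emb? W φ) ∎)
      where
      bool-𝟙 : ∀ b → ⟦ b ⟧ ≡ 𝟙 (b ≟ᵇ true)
      bool-𝟙 true  = refl
      bool-𝟙 false = refl
    ... | no none = begin
          𝟙 (emb? U φ) + ∑ (allFin r) (λ y → ⟦ fits S (role y) φ ⟧)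
            ≡⟨ cong (𝟙 (emb? U φ) +_) (trans (∑-cong (allFin r) never) (∑-zero (allFin r))) ⟩
          𝟙 (emb? U φ) + 0
            ≡⟨ +-identityʳ _ ⟩
          𝟙 (emb? U φ)
            ≤⟨ 𝟙-mono (emb? U φ) (emb? W φ) (λ (mem , rest) → (λ i → U⊆W _ (mem i)) , rest) ⟩
          𝟙 (emb? W φ) ∎
      where
      never : ∀ y → ⟦ fits S (role y) φ ⟧ ≡ 0
      never y with fits S (role y) φ in eq
      ... | true  = ⊥-elim (none (y , eq))
      ... | false = refl

-- Copies versus embeddings

bool-ext : ∀ {a b} → (a ≡ true → b ≡ true) → (b ≡ true → a ≡ true) → a ≡ b
bool-ext {true}  {b}     f g = ≡-sym (f refl)
bool-ext {false} {true}  f g = g refl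
bool-ext {false} {false} f g = refl

⇒ᵇ-sound : ∀ {a b} → (a ⇒ᵇ b) ≡ true → a ≡ true → b ≡ true
⇒ᵇ-sound {true} h refl = h

⇒ᵇ-complete : ∀ {a b} → (a ≡ true → b ≡ true) → (a ⇒ᵇ b) ≡ true
⇒ᵇ-complete {true}  h = h refl
⇒ᵇ-complete {false} h = refl

⇔ᵇ-sound : ∀ {a b} → (a ⇔ᵇ b) ≡ true → a ≡ b
⇔ᵇ-sound {true}  {true}  _ = refl
⇔ᵇ-sound {false} {false} _ = refl

⇔ᵇ-complete : ∀ {a b} → a ≡ b → (a ⇔ᵇ b) ≡ true
⇔ᵇ-complete {true}  refl = refl
⇔ᵇ-complete {false} refl = refl

module _ (p : A → Bool) where
  all-sound : ∀ xs → foldr (λ i b → p i ∧ b) true xs ≡ true → ∀ {x} → x ∈ xs → p x ≡ true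
  all-sound (x ∷ xs) h (here refl) = proj₁ (∧-true h)
  all-sound (x ∷ xs) h (there x∈)  = all-sound xs (proj₂ (∧-true {p x} h)) x∈

  all-complete : ∀ xs → (∀ x → p x ≡ true) → foldr (λ i b → p i ∧ b) true xs ≡ true
  all-complete []       h = refl
  all-complete (x ∷ xs) h = ∧-intro (h x) (all-complete xs h)

  any-sound : ∀ xs → foldr (λ i b → p i ∨ b) false xs ≡ true → ∃ λ x → p x ≡ true
  any-sound (x ∷ xs) h with p x in eq
  ... | true  = x , eq
  ... | false = any-sound xs h

  any-complete : ∀ xs {x} → x ∈ xs → p x ≡ true → foldr (λ i b → p i ∨ b) false xs ≡ true
  any-complete (x ∷ xs) (here refl) px rewrite px = refl
  any-complete (x ∷ xs) (there x∈)  px with p x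
  ... | true  = refl
  ... | false = any-complete xs x∈ px

  any-none : ∀ xs → foldr (λ i b → p i ∨ b) false xs ≡ false → ∑ xs (λ x → ⟦ p x ⟧) ≡ 0
  any-none []       h = refl
  any-none (x ∷ xs) h with p x
  ... | false = any-none xs h

allB-sound : ∀ (p : Fin n → Bool) → allB n p ≡ true → ∀ i → p i ≡ true
allB-sound {n} p h i = all-sound _ (allFin n) h (∈-allFin i)

allB-complete : ∀ {p : Fin n → Bool} → (∀ i → p i ≡ true) → allB n p ≡ true
allB-complete {n} = all-complete _ (allFin n)

vec-ext : ∀ {v w : Vec A m} → (∀ i → lookup v i ≡ lookup w i) → v ≡ w
vec-ext {v = v} {w} h = trans (≡-sym (tabulate∘lookup v)) (trans (tabulate-cong h) (tabulate∘lookup w))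

module Copies {r n : ℕ} (H : SimpleGraph r) (G : SimpleGraph n) where
  open Embeddings H G

  Edges : ℕ → Set
  Edges n = Vec (Vec Bool n) n

  edge : Edges n → Fin n → Fin n → Bool
  edge E u v = lookup (lookup E u) v

  maps : List (Vec (Fin n) r)
  maps = vecsOver (allFin n) r

  perms : List (Vec (Fin r) r)
  perms = vecsOver (allFin r) r

  module Maps  = Enumeration (finiteVec (finiteFin n) r)
  module Perms = Enumeration (finiteVec (finiteFin r) r)
  module Subgraphs = Enumeration
    (finite× (finiteVec finiteBool n) (finiteVec (finiteVec finiteBool n) n))

  injB : Vec (Fin n) r → Fin r → Fin r → Bool
  injB φ i j = (lookup φ i =ᶠ lookup φ j) ⇒ᵇ (i =ᶠ j)

  covB : Vec Bool n → Vec (Fin n) r → Fin n → Bool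
  covB S φ v = lookup S v ⇔ᵇ anyB r (λ i → lookup φ i =ᶠ v)

  edgB : Edges n → Vec (Fin n) r → Fin r → Fin r → Bool
  edgB E φ i j = adj H i j ⇔ᵇ edge E (lookup φ i) (lookup φ j)

  -- A named copy of the test local to `isoTo`, written so that the two agree definitionally; `isos`
  -- below checks this by `refl`.
  isIso : Vec Bool n → Edges n → Vec (Fin n) r → Bool
  isIso S E φ = (allB r λ i → allB r (injB φ i)) ∧ allB n (covB S φ) ∧ (allB r λ i → allB r (edgB E φ i))

  Covers : Vec Bool n → Vec (Fin n) r → Set
  Covers S φ = (∀ v → lookup S v ≡ true → ∃ λ i → lookup φ i ≡ v) × (∀ i → lookup S (lookup φ i) ≡ true)

  Iso : Vec Bool n → Edges n → Vec (Fin n) r → Set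
  Iso S E φ = Injective φ × Covers S φ × (∀ i j → adj H i j ≡ edge E (lookup φ i) (lookup φ j))

  isIso-sound : ∀ S E φ → isIso S E φ ≡ true → Iso S E φ
  isIso-sound S E φ h with ∧-true {allB r (λ i → allB r (injB φ i))} h
  ... | h₁ , h₂₃ with ∧-true {allB n (covB S φ)} h₂₃
  ...   | h₂ , h₃ =
      (λ i j eq → does-true (i ≟ᶠ j) (⇒ᵇ-sound (allB-sound (injB φ i) (allB-sound (λ i → allB r (injB φ i)) h₁ i) j) (dec-true (lookup φ i ≟ᶠ lookup φ j) eq)))
    , ((λ v Sv → let i , eq = any-sound (λ i → lookup φ i =ᶠ v) (allFin r) (trans (≡-sym (⇔ᵇ-sound (allB-sound (covB S φ) h₂ v))) Sv)
                 in i , does-true (lookup φ i ≟ᶠ v) eq)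
      , (λ i → trans (⇔ᵇ-sound (allB-sound (covB S φ) h₂ (lookup φ i)))
                 (any-complete (λ j → lookup φ j =ᶠ lookup φ i) (allFin r) (∈-allFin i) (dec-true (lookup φ i ≟ᶠ lookup φ i) refl))))
    , (λ i j → ⇔ᵇ-sound (allB-sound (edgB E φ i) (allB-sound (λ i → allB r (edgB E φ i)) h₃ i) j))

  isIso-complete : ∀ S E φ → Iso S E φ → isIso S E φ ≡ true
  isIso-complete S E φ (inj , (cov , mem) , edges) = ∧-intro
    (allB-complete λ i → allB-complete λ j → ⇒ᵇ-complete λ h →
       dec-true (i ≟ᶠ j) (inj i j (does-true (lookup φ i ≟ᶠ lookup φ j) h)))
    (∧-intro
      (allB-complete λ v → ⇔ᵇ-complete (bool-ext
         (λ Sv → let i , eq = cov v Sv in any-complete (λ j → lookup φ j =ᶠ v) (allFin r) (∈-allFin i) (dec-true (lookup φ i ≟ᶠ v) eq))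
         (λ h → let i , eq = any-sound (λ j → lookup φ j =ᶠ v) (allFin r) h
                in subst (λ z → lookup S z ≡ true) (does-true (lookup φ i ≟ᶠ v) eq) (mem i))))
      (allB-complete λ i → allB-complete λ j → ⇔ᵇ-complete (edges i j)))

  Valid : Vec Bool n → Edges n → Set
  Valid S E = (∀ u v → edge E u v ≡ true → adj G u v ≡ true × lookup S u ≡ true × lookup S v ≡ true)
            × (∀ u v → edge E u v ≡ edge E v u)

  validSub-sound : ∀ S E → validSub G S E ≡ true → Valid S E
  validSub-sound S E h =
      (λ u v e → let a , b = ∧-true {adj G u v} (⇒ᵇ-sound (proj₁ (both u v)) e) in a , ∧-true b)
    , (λ u v → ⇔ᵇ-sound (proj₂ (both u v)))
    where
    within symmetric : Fin n → Fin n → Bool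
    within u v = edge E u v ⇒ᵇ (adj G u v ∧ lookup S u ∧ lookup S v)
    symmetric u v = edge E u v ⇔ᵇ edge E v u
    both : ∀ u v → within u v ≡ true × symmetric u v ≡ true
    both u v = ∧-true (allB-sound (λ v → within u v ∧ symmetric u v)
      (allB-sound (λ u → allB n λ v → within u v ∧ symmetric u v) h u) v)

  validSub-complete : ∀ S E → Valid S E → validSub G S E ≡ true
  validSub-complete S E (sub , symm) = allB-complete λ u → allB-complete λ v → ∧-intro
    (⇒ᵇ-complete (λ e → let a , b , c = sub u v e in ∧-intro a (∧-intro b c)))
    (⇔ᵇ-complete (symm u v))

  Aut : Vec (Fin r) r → Set
  Aut α = Injective α × (∀ j → ∃ λ i → lookup α i ≡ j)
        × (∀ i j → adj H i j ≡ adj H (lookup α i) (lookup α j))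

  aut? : ∀ α → Dec (Aut α)
  aut? α = all? (λ i → all? λ j → (lookup α i ≟ᶠ lookup α j) →-dec (i ≟ᶠ j))
     ×-dec all? (λ j → any? λ i → lookup α i ≟ᶠ j)
     ×-dec all? (λ i → all? λ j → adj H i j ≟ᵇ adj H (lookup α i) (lookup α j))

  aut : ℕ
  aut = ∑ perms (λ α → 𝟙 (aut? α))

  1≤aut : 1 ≤ aut
  1≤aut = ≤-trans (≤-reflexive (≡-sym (𝟙-true (aut? ι) aut-ι))) (Perms.∑-lower (λ α → 𝟙 (aut? α)) ι)
    where
    ι : Vec (Fin r) r
    ι = Vec.tabulate id
    at : ∀ i → lookup ι i ≡ i
    at = lookup∘tabulate id
    aut-ι : Aut ι
    aut-ι = (λ i j eq → trans (≡-sym (at i)) (trans eq (at j))) , (λ j → j , at j)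
          , (λ i j → ≡-sym (cong₂ (adj H) (at i) (at j)))

  -- Any two isomorphisms onto the same subgraph differ by an automorphism of H.
  count-isos : ∀ S E φ₀ → Iso S E φ₀ → ∑ maps (λ φ → ⟦ isIso S E φ ⟧) ≡ aut
  count-isos S E φ₀ (inj₀ , (cov₀ , mem₀) , edges₀) = begin
    ∑ maps (λ φ → ⟦ isIso S E φ ⟧)
      ≡⟨ ∑-cong maps (λ φ → ≡-sym (fibre φ)) ⟩
    ∑ maps (λ φ → ∑ perms (λ α → 𝟙 (aut? α ×-dec (after α ≟ᵐ φ))))
      ≡⟨ ∑-swap maps perms _ ⟩
    ∑ perms (λ α → ∑ maps (λ φ → 𝟙 (aut? α ×-dec (after α ≟ᵐ φ))))
      ≡⟨ ∑-cong perms (λ α → trans (∑-cong maps (λ φ → ⟦∧⟧ (does (aut? α)) _))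
           (trans (∑-*ˡ maps _ (𝟙 (aut? α))) (trans (cong (𝟙 (aut? α) *_) (Finite.once (finiteVec (finiteFin n) r) (after α))) (*-identityʳ _)))) ⟩
    aut ∎
    where
    open ≡-Reasoning
    open Finite (finiteVec (finiteFin n) r) using () renaming (_≟_ to _≟ᵐ_)
    after : Vec (Fin r) r → Vec (Fin n) r
    after α = Vec.map (lookup φ₀) α

    at : ∀ α i → lookup (after α) i ≡ lookup φ₀ (lookup α i)
    at α i = lookup-map i (lookup φ₀) α

    aut⇒iso : ∀ α → Aut α → Iso S E (after α)
    aut⇒iso α (inj , surj , hom) =
        (λ i j eq → inj i j (inj₀ _ _ (trans (≡-sym (at α i)) (trans eq (at α j)))))
      , ((λ v Sv → let j , eq = cov₀ v Sv; i , eq′ = surj j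
                   in i , trans (at α i) (trans (cong (lookup φ₀) eq′) eq))
        , (λ i → subst (λ z → lookup S z ≡ true) (≡-sym (at α i)) (mem₀ (lookup α i))))
      , (λ i j → trans (hom i j) (trans (edges₀ _ _) (≡-sym (cong₂ (edge E) (at α i) (at α j)))))

    iso⇒aut : ∀ φ → Iso S E φ → ∃ λ α → Aut α × after α ≡ φ
    iso⇒aut φ (inj , (cov , mem) , edges) = α , (inj-α , surj-α , hom-α) , vec-ext (λ i → trans (at α i) (α-φ i))
      where
      -- `α` is `φ` followed by the inverse of `φ₀` on the common vertex set; the covering property
      -- of `φ₀` supplies the preimages.
      α : Vec (Fin r) r
      α = Vec.tabulate (λ i → proj₁ (cov₀ (lookup φ i) (mem i)))
      α-φ : ∀ i → lookup φ₀ (lookup α i) ≡ lookup φ i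
      α-φ i = trans (cong (lookup φ₀) (lookup∘tabulate _ i)) (proj₂ (cov₀ (lookup φ i) (mem i)))
      inj-α : Injective α
      inj-α i j eq = inj i j (trans (≡-sym (α-φ i)) (trans (cong (lookup φ₀) eq) (α-φ j)))
      surj-α : ∀ j → ∃ λ i → lookup α i ≡ j
      surj-α j = let i , eq = cov (lookup φ₀ j) (mem₀ j) in i , inj₀ _ _ (trans (α-φ i) eq)
      hom-α : ∀ i j → adj H i j ≡ adj H (lookup α i) (lookup α j)
      hom-α i j = trans (edges i j) (trans (≡-sym (cong₂ (edge E) (α-φ i) (α-φ j))) (≡-sym (edges₀ _ _)))

    fibre : ∀ φ → ∑ perms (λ α → 𝟙 (aut? α ×-dec (after α ≟ᵐ φ))) ≡ ⟦ isIso S E φ ⟧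
    fibre φ with isIso S E φ in eq
    ... | true  = let α , aut-α , α-φ = iso⇒aut φ (isIso-sound S E φ eq) in
      Perms.∑-unique (λ α → aut? α ×-dec (after α ≟ᵐ φ)) α (aut-α , α-φ)
        (λ β (_ , β-φ) → vec-ext (λ i → inj₀ _ _
          (trans (≡-sym (at α i)) (trans (cong (λ z → lookup z i) (trans α-φ (≡-sym β-φ))) (at β i)))))
    ... | false = Perms.∑-none (λ α → aut? α ×-dec (after α ≟ᵐ φ))
      λ { α (aut-α , refl) → true≢false (isIso-complete S E (after α) (aut⇒iso α aut-α)) eq }

  hit? : ∀ (φ : Vec (Fin n) r) v → Dec (∃ λ i → lookup φ i ≡ v)
  hit? φ v = any? λ i → lookup φ i ≟ᶠ v

  ImageEdge : Vec (Fin n) r → Fin n → Fin n → Set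
  ImageEdge φ u v = ∃ λ i → ∃ λ j → lookup φ i ≡ u × lookup φ j ≡ v × adj H i j ≡ true

  imageEdge? : ∀ (φ : Vec (Fin n) r) u v → Dec (ImageEdge φ u v)
  imageEdge? φ u v = any? λ i → any? λ j → (lookup φ i ≟ᶠ u) ×-dec (lookup φ j ≟ᶠ v) ×-dec (adj H i j ≟ᵇ true)

  -- The only subgraph onto which `φ` can be an isomorphism, so that each embedding belongs to
  -- exactly one copy.
  image : Vec (Fin n) r → Vec Bool n × Edges n
  image φ = Vec.tabulate (λ v → does (hit? φ v))
          , Vec.tabulate (λ u → Vec.tabulate (λ v → does (imageEdge? φ u v)))

  Occurs : Vec Bool n × Edges n → Vec (Fin n) r → Set
  Occurs (S , E) φ = validSub G S E ∧ isIso S E φ ≡ true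

  image-∈ : ∀ φ v → lookup (proj₁ (image φ)) v ≡ true → ∃ λ i → lookup φ i ≡ v
  image-∈ φ v h = does-true (hit? φ v) (trans (≡-sym (lookup∘tabulate _ v)) h)

  image-∋ : ∀ φ v → (∃ λ i → lookup φ i ≡ v) → lookup (proj₁ (image φ)) v ≡ true
  image-∋ φ v p = trans (lookup∘tabulate _ v) (dec-true (hit? φ v) p)

  edge-tabulate : ∀ (e : Fin n → Fin n → Bool) u v → edge (Vec.tabulate (λ u → Vec.tabulate (e u))) u v ≡ e u v
  edge-tabulate e u v = trans (cong (λ z → lookup z v) (lookup∘tabulate _ u)) (lookup∘tabulate _ v)

  image-edge : ∀ φ u v → edge (proj₂ (image φ)) u v ≡ true → ImageEdge φ u v
  image-edge φ u v h = does-true (imageEdge? φ u v) (trans (≡-sym (edge-tabulate (λ u v → does (imageEdge? φ u v)) u v)) h)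

  edge-image : ∀ φ u v → ImageEdge φ u v → edge (proj₂ (image φ)) u v ≡ true
  edge-image φ u v p = trans (edge-tabulate (λ u v → does (imageEdge? φ u v)) u v) (dec-true (imageEdge? φ u v) p)

  image-occurs : ∀ φ → Emb full φ → Occurs (image φ) φ
  image-occurs φ (_ , inj , hom) = ∧-intro
    (validSub-complete S E
      ( (λ u v e → inside u v (image-edge φ u v e))
      , (λ u v → bool-ext (flip-edge u v) (flip-edge v u))))
    (isIso-complete S E φ
      ( inj
      , (image-∈ φ , λ i → image-∋ φ _ (i , refl))
      , λ i j → bool-ext (λ h → edge-image φ _ _ (i , j , refl , refl , h)) (λ h → adjacent i j (image-edge φ _ _ h))))
    where
    S = proj₁ (image φ)
    E = proj₂ (image φ)
    inside : ∀ u v → ImageEdge φ u v → adj G u v ≡ true × lookup S u ≡ true × lookup S v ≡ true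
    inside u v (i , j , refl , refl , h) = hom i j h , image-∋ φ u (i , refl) , image-∋ φ v (j , refl)
    flip-edge : ∀ u v → edge E u v ≡ true → edge E v u ≡ true
    flip-edge u v e = let i , j , p , q , h = image-edge φ u v e in
      edge-image φ v u (j , i , q , p , trans (SimpleGraph.sym H j i) h)
    adjacent : ∀ i j → ImageEdge φ (lookup φ i) (lookup φ j) → adj H i j ≡ true
    adjacent i j (i′ , j′ , p , q , h) = subst₂ (λ x y → adj H x y ≡ true) (inj i′ i p) (inj j′ j q) h

  occurs⇒image : ∀ φ p → Occurs p φ → image φ ≡ p
  occurs⇒image φ (S , E) h with ∧-true {validSub G S E} h
  ... | hv , hi with validSub-sound S E hv | isIso-sound S E φ hi
  ...   | sub , symm | inj , (cov , mem) , edges = cong₂ _,_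
      (vec-ext λ v → bool-ext (λ s → let i , eq = image-∈ φ v s in subst (λ z → lookup S z ≡ true) eq (mem i))
                              (λ s → image-∋ φ v (cov v s)))
      (vec-ext λ u → vec-ext λ v → bool-ext
        (λ e → to u v (image-edge φ u v e))
        (λ e → edge-image φ u v (from u v e)))
    where
    to : ∀ u v → ImageEdge φ u v → edge E u v ≡ true
    to u v (i , j , refl , refl , hij) = trans (≡-sym (edges i j)) hij
    from : ∀ u v → edge E u v ≡ true → ImageEdge φ u v
    from u v e with sub u v e
    ... | _ , Su , Sv with cov u Su | cov v Sv
    ...   | i , refl | j , refl = i , j , refl , refl , trans (edges i j) e

  occurs⇒emb : ∀ φ p → Occurs p φ → Emb full φ
  occurs⇒emb φ (S , E) h with ∧-true {validSub G S E} h
  ... | hv , hi with validSub-sound S E hv | isIso-sound S E φ hi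
  ...   | sub , symm | inj , _ , edges =
    (λ _ → refl) , inj , (λ i j hij → proj₁ (sub _ _ (trans (≡-sym (edges i j)) hij)))

  -- Pairs of a subgraph and an isomorphism onto it are counted in two ways: a subgraph takes part
  -- in `aut` pairs if it is a copy and in none otherwise, and a map in one pair if it is an
  -- embedding and in none otherwise.
  N*aut≡embs : N H G * aut ≡ embs full
  N*aut≡embs = begin
    N H G * aut
      ≡⟨ ∑-*ʳ (subgraphs n) _ aut ⟨
    ∑ (subgraphs n) (λ p → ⟦ validSub G (proj₁ p) (proj₂ p) ∧ isoTo H (proj₁ p) (proj₂ p) ⟧ * aut)
      ≡⟨ ∑-cong (subgraphs n) (λ p → per-subgraph (proj₁ p) (proj₂ p)) ⟩
    ∑ (subgraphs n) (λ p → ∑ maps (λ φ → 𝟙 (occurs? p φ)))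
      ≡⟨ ∑-swap (subgraphs n) maps _ ⟩
    ∑ maps (λ φ → ∑ (subgraphs n) (λ p → 𝟙 (occurs? p φ)))
      ≡⟨ ∑-cong maps per-map ⟩
    embs full ∎
    where
    open ≡-Reasoning
    occurs? : ∀ p φ → Dec (Occurs p φ)
    occurs? (S , E) φ = (validSub G S E ∧ isIso S E φ) ≟ᵇ true

    𝟙-≟ : ∀ b → 𝟙 (b ≟ᵇ true) ≡ ⟦ b ⟧
    𝟙-≟ true  = refl
    𝟙-≟ false = refl

    per-subgraph : ∀ S E → ⟦ validSub G S E ∧ isoTo H S E ⟧ * aut
                         ≡ ∑ maps (λ φ → 𝟙 ((validSub G S E ∧ isIso S E φ) ≟ᵇ true))
    per-subgraph S E = trans (go (validSub G S E)) (∑-cong maps (λ φ → ≡-sym (𝟙-≟ (validSub G S E ∧ isIso S E φ))))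
      where
      isos : isoTo H S E ≡ foldr (λ φ b → isIso S E φ ∨ b) false maps
      isos = refl
      go : ∀ b → ⟦ b ∧ isoTo H S E ⟧ * aut ≡ ∑ maps (λ φ → ⟦ b ∧ isIso S E φ ⟧)
      go false = ≡-sym (∑-zero maps)
      go true with isoTo H S E in eq
      ... | true  = let φ₀ , h = any-sound (isIso S E) maps (trans (≡-sym isos) eq)
                    in trans (+-identityʳ aut) (≡-sym (count-isos S E φ₀ (isIso-sound S E φ₀ h)))
      ... | false = ≡-sym (any-none (isIso S E) maps (trans (≡-sym isos) eq))

    per-map : ∀ φ → ∑ (subgraphs n) (λ p → 𝟙 (occurs? p φ)) ≡ 𝟙 (emb? full φ)
    per-map φ = go (emb? full φ)
      where
      go : (d : Dec (Emb full φ)) → ∑ (subgraphs n) (λ p → 𝟙 (occurs? p φ)) ≡ 𝟙 d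
      go (yes e) = Subgraphs.∑-unique (λ p → occurs? p φ) (image φ) (image-occurs φ e) (occurs⇒image φ)
      go (no ¬e) = Subgraphs.∑-none (λ p → occurs? p φ) (λ p → ¬e ∘ occurs⇒emb φ p)

-- The factor `aut` depends on `H` alone and is positive because of the identity, so it cancels even
-- between host graphs of different orders.
copies-mono : ∀ {r n₁ n₂} (H : SimpleGraph r) (G : SimpleGraph n₁) (G′ : SimpleGraph n₂) →
              Embeddings.embs H G full ≤ Embeddings.embs H G′ full → N H G ≤ N H G′
copies-mono H G G′ le = *-cancelʳ-≤ (N H G) (N H G′) (Copies.aut H G) ⦃ >-nonZero (Copies.1≤aut H G) ⦄
  (subst₂ _≤_ (≡-sym (Copies.N*aut≡embs H G)) (≡-sym (Copies.N*aut≡embs H G′)) le)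

-- Matchings and the closure

Pairs : ℕ → Set
Pairs n = List (Fin n × Fin n)

ends : Pairs n → List (Fin n)
ends []            = []
ends ((a , b) ∷ M) = a ∷ b ∷ ends M

-- Lists instead of functions on `Fin t` let a matching be altered edge by edge in a recursion, and
-- a single `Unique` holds all disjointness conditions.
Matching : SimpleGraph n → Pairs n → Set
Matching G M = All (λ (a , b) → adj G a b ≡ true) M × Unique (ends M)

MatchingBound : SimpleGraph n → ℕ → Set
MatchingBound G c = ∀ M → Matching G M → length M ≤ c

module _ (G : SimpleGraph n) where

  ends-lookup : ∀ (M : Pairs n) i → proj₁ (List.lookup M i) ∈ ends M × proj₂ (List.lookup M i) ∈ ends M
  ends-lookup ((a , b) ∷ M) zero    = here refl , there (here refl)
  ends-lookup ((a , b) ∷ M) (suc i) with ends-lookup M i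
  ... | p , q = there (there p) , there (there q)

  matching⇒IsMatching : ∀ M → Matching G M → IsMatching G (length M) (List.lookup M)
  matching⇒IsMatching M (edges , uniq) = (λ e → All.lookup edges (∈-lookup e)) , disjoint M uniq
    where
    open import Data.List.Membership.Propositional.Properties using (∈-lookup)
    Disjoint : Fin n × Fin n → Fin n × Fin n → Set
    Disjoint e e′ = (proj₁ e ≢ proj₁ e′) × (proj₁ e ≢ proj₂ e′) × (proj₂ e ≢ proj₁ e′) × (proj₂ e ≢ proj₂ e′)
    disjoint : ∀ M → Unique (ends M) → ∀ i j → i ≢ j → Disjoint (List.lookup M i) (List.lookup M j)
    disjoint (e ∷ M) _ zero    zero    i≢j = ⊥-elim (i≢j refl)
    disjoint (e ∷ M) ((_ ∷ a∉) ∷ b∉ ∷ _) zero (suc j) _ with ends-lookup M j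
    ... | p , q = All.lookup a∉ p , All.lookup a∉ q , All.lookup b∉ p , All.lookup b∉ q
    disjoint (e ∷ M) ((_ ∷ a∉) ∷ b∉ ∷ _) (suc i) zero _ with ends-lookup M i
    ... | p , q = All.lookup a∉ p ∘ ≡-sym , All.lookup b∉ p ∘ ≡-sym , All.lookup a∉ q ∘ ≡-sym , All.lookup b∉ q ∘ ≡-sym
    disjoint (e ∷ M) (_ ∷ _ ∷ uniq) (suc i) (suc j) i≢j = disjoint M uniq i j (i≢j ∘ cong suc)

∉⇒All≢ : ∀ {x : A} {xs} → x ∉ xs → All (x ≢_) xs
∉⇒All≢ x∉ = All.tabulate (λ { y∈ refl → x∉ y∈ })

neighbours : SimpleGraph n → Fin n → List (Fin n) → ℕ
neighbours G u xs = countB (adj G u) xs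

degree-≤-neighbours : ∀ (G : SimpleGraph n) u xs → (∀ w → adj G u w ≡ true → w ∈ xs) → degree G u ≤ neighbours G u xs
degree-≤-neighbours {n} G u xs inside = begin
  degree G u
    ≤⟨ ∑-mono (allFin n) at ⟩
  ∑ (allFin n) (λ w → ∑ xs (λ y → 𝟙 (y ≟ᶠ w) * ⟦ adj G u w ⟧))
    ≡⟨ ∑-swap (allFin n) xs _ ⟩
  ∑ xs (λ y → ∑ (allFin n) (λ w → 𝟙 (y ≟ᶠ w) * ⟦ adj G u w ⟧))
    ≡⟨ ∑-cong xs (λ y → ∑Fin-δ y (λ w → ⟦ adj G u w ⟧)) ⟩
  neighbours G u xs ∎
  where
  open ≤-Reasoning
  at : ∀ w → ⟦ adj G u w ⟧ ≤ ∑ xs (λ y → 𝟙 (y ≟ᶠ w) * ⟦ adj G u w ⟧)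
  at w with adj G u w in eq
  ... | false = z≤n
  ... | true  = ≤-trans (≤-reflexive (≡-sym (cong (_* 1) (𝟙-true (w ≟ᶠ w) refl))))
                        (∑-∈ (λ y → 𝟙 (y ≟ᶠ w) * 1) (inside w eq))

_⊆ₗ_ : List A → List A → Set
xs ⊆ₗ ys = ∀ {x} → x ∈ xs → x ∈ ys

module Augment (G : SimpleGraph n) where

  -- Some edge ab of M sends three edges to {u, v}; trade it for ua, vb or ub, va.
  rotate : ∀ {u v} → u ≢ v → ∀ M → Matching G M → u ∉ ends M → v ∉ ends M →
           suc (2 * length M) ≤ neighbours G u (ends M) + neighbours G v (ends M) →
           ∃ λ M′ → Matching G M′ × length M′ ≡ suc (length M) × ends M′ ⊆ₗ (u ∷ v ∷ ends M)
  rotate {u} {v} u≢v ((a , b) ∷ M) (ab ∷ edges , (a≢b ∷ a∉) ∷ b∉ ∷ uniq) u∉ v∉ big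
    with (adj G u a ≟ᵇ true) ×-dec (adj G v b ≟ᵇ true) | (adj G u b ≟ᵇ true) ×-dec (adj G v a ≟ᵇ true)
  ... | yes (ua , vb) | _ = (u , a) ∷ (v , b) ∷ M
        , (ua ∷ vb ∷ edges
          , (u∉ ∘ here ∷ u≢v ∷ u∉ ∘ there ∘ here ∷ ∉⇒All≢ (u∉ ∘ there ∘ there))
          ∷ ((v∉ ∘ here ∘ ≡-sym) ∷ a≢b ∷ a∉)
          ∷ (v∉ ∘ there ∘ here ∷ ∉⇒All≢ (v∉ ∘ there ∘ there))
          ∷ b∉ ∷ uniq)
        , refl
        , λ { (here refl) → here refl ; (there (here refl)) → there (there (here refl))
            ; (there (there (here refl))) → there (here refl)
            ; (there (there (there (here refl)))) → there (there (there (here refl)))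
            ; (there (there (there (there w)))) → there (there (there (there w))) }
  ... | no _ | yes (ub , va) = (u , b) ∷ (v , a) ∷ M
        , (ub ∷ va ∷ edges
          , (u∉ ∘ there ∘ here ∷ u≢v ∷ u∉ ∘ here ∷ ∉⇒All≢ (u∉ ∘ there ∘ there))
          ∷ ((v∉ ∘ there ∘ here ∘ ≡-sym) ∷ (a≢b ∘ ≡-sym) ∷ b∉)
          ∷ (v∉ ∘ here ∷ ∉⇒All≢ (v∉ ∘ there ∘ there))
          ∷ a∉ ∷ uniq)
        , refl
        , λ { (here refl) → here refl ; (there (here refl)) → there (there (there (here refl)))
            ; (there (there (here refl))) → there (here refl)
            ; (there (there (there (here refl)))) → there (there (here refl))
            ; (there (there (there (there w)))) → there (there (there (there w))) }
  ... | no ¬₁ | no ¬₂ with rotate u≢v M (edges , uniq) (u∉ ∘ there ∘ there) (v∉ ∘ there ∘ there) big′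
    where
    at-most-one : ∀ {x y} → ¬ (x ≡ true × y ≡ true) → ⟦ x ⟧ + ⟦ y ⟧ ≤ 1
    at-most-one {true}  {true}  h = ⊥-elim (h (refl , refl))
    at-most-one {true}  {false} h = ≤-refl
    at-most-one {false} {y}     h = ⟦⟧-mono {y} {true} (λ _ → refl)
    rearrange : ∀ p q s t x y → (p + (q + x)) + (s + (t + y)) ≡ (p + t) + (q + s) + (x + y)
    rearrange = solve-∀
    two : ∀ l → suc (2 * suc l) ≡ 2 + suc (2 * l)
    two = solve-∀
    big′ : suc (2 * length M) ≤ neighbours G u (ends M) + neighbours G v (ends M)
    big′ = +-cancelˡ-≤ 2 _ _ (begin
      2 + suc (2 * length M)
        ≡⟨ two (length M) ⟨
      suc (2 * suc (length M))
        ≤⟨ big ⟩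
      neighbours G u (a ∷ b ∷ ends M) + neighbours G v (a ∷ b ∷ ends M)
        ≡⟨ rearrange ⟦ adj G u a ⟧ ⟦ adj G u b ⟧ ⟦ adj G v a ⟧ ⟦ adj G v b ⟧ _ _ ⟩
      (⟦ adj G u a ⟧ + ⟦ adj G v b ⟧) + (⟦ adj G u b ⟧ + ⟦ adj G v a ⟧) + (neighbours G u (ends M) + neighbours G v (ends M))
        ≤⟨ +-monoˡ-≤ _ (+-mono-≤ (at-most-one ¬₁) (at-most-one ¬₂)) ⟩
      2 + (neighbours G u (ends M) + neighbours G v (ends M)) ∎)
      where open ≤-Reasoning
  ...   | M′ , (edges′ , uniq′) , len , sub = (a , b) ∷ M′
        , (ab ∷ edges′
          , (a≢b ∷ fresh (u∉ ∘ here ∘ ≡-sym) (v∉ ∘ here ∘ ≡-sym) a∉)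
          ∷ fresh (u∉ ∘ there ∘ here ∘ ≡-sym) (v∉ ∘ there ∘ here ∘ ≡-sym) b∉
          ∷ uniq′)
        , cong suc len
        , λ { (here refl) → there (there (here refl)) ; (there (here refl)) → there (there (there (here refl)))
            ; (there (there w)) → weaken (sub w) }
    where
    fresh : ∀ {x} → x ≢ u → x ≢ v → All (x ≢_) (ends M) → All (x ≢_) (ends M′)
    fresh x≢u x≢v x∉ = All.tabulate (λ w → All.lookup (x≢u ∷ x≢v ∷ x∉) (sub w))
    weaken : (u ∷ v ∷ ends M) ⊆ₗ (u ∷ v ∷ a ∷ b ∷ ends M)
    weaken (here refl)         = here refl
    weaken (there (here refl)) = there (here refl)
    weaken (there (there w))   = there (there (there (there w)))

  extend : ∀ {x} M → Matching G M → x ∉ ends M → ∀ w → adj G x w ≡ true → w ∉ ends M →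
           ∃ λ M′ → Matching G M′ × length M′ ≡ suc (length M)
  extend {x} M (edges , uniq) x∉ w xw w∉ = (x , w) ∷ M
    , (xw ∷ edges , ((λ { refl → true≢false xw (irrefl G x) }) ∷ ∉⇒All≢ x∉) ∷ ∉⇒All≢ w∉ ∷ uniq) , refl

  -- If `u` or `v` has a neighbour not met by `M`, that edge is added. Otherwise all edges at `u`
  -- and `v` go to ends of `M`, and more than `2 * length M` of them force some matching edge to
  -- receive three, which is the case of `rotate`.
  augment : ∀ {u v} → u ≢ v → ∀ M → Matching G M → u ∉ ends M → v ∉ ends M →
            suc (2 * length M) ≤ degree G u + degree G v →
            ∃ λ M′ → Matching G M′ × length M′ ≡ suc (length M)
  augment {u} {v} u≢v M (edges , uniq) u∉ v∉ big with escape? u | escape? v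
    where
    open import Data.List.Membership.DecPropositional (_≟ᶠ_ {n}) using (_∈?_)
    escape? : ∀ x → Dec (∃ λ w → adj G x w ≡ true × w ∉ ends M)
    escape? x = any? λ w → (adj G x w ≟ᵇ true) ×-dec ¬? (w ∈? ends M)
  ... | yes (w , uw , w∉) | _ = extend M (edges , uniq) u∉ w uw w∉
  ... | no _ | yes (w , vw , w∉) = extend M (edges , uniq) v∉ w vw w∉
  ... | no stay-u | no stay-v = M′ , match , len
    where
    open import Data.List.Membership.DecPropositional (_≟ᶠ_ {n}) using (_∈?_)
    open import Relation.Nullary.Decidable using (decidable-stable)
    stays : ∀ {x} → ¬ (∃ λ w → adj G x w ≡ true × w ∉ ends M) → ∀ w → adj G x w ≡ true → w ∈ ends M
    stays no-escape w xw = decidable-stable (w ∈? ends M) (λ w∉ → no-escape (w , xw , w∉))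
    rotated = rotate u≢v M (edges , uniq) u∉ v∉ (≤-trans big
      (+-mono-≤ (degree-≤-neighbours G u (ends M) (stays stay-u)) (degree-≤-neighbours G v (ends M) (stays stay-v))))
    M′ = proj₁ rotated
    match = proj₁ (proj₂ rotated)
    len = proj₁ (proj₂ (proj₂ rotated))

joins : Fin n → Fin n → Fin n → Fin n → Bool
joins u v i j = (u =ᶠ i ∧ v =ᶠ j) ∨ (u =ᶠ j ∧ v =ᶠ i)

addEdge : (G : SimpleGraph n) (u v : Fin n) → u ≢ v → SimpleGraph n
addEdge G u v u≢v = record
  { adj    = λ i j → adj G i j ∨ joins u v i j
  ; sym    = λ i j → cong₂ _∨_ (SimpleGraph.sym G i j) (∨-comm (u =ᶠ i ∧ v =ᶠ j) _)
  ; irrefl = λ i → cong₂ _∨_ (irrefl G i) (cong₂ _∨_ (apart i) (apart i))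
  }
  where
  apart : ∀ i → (u =ᶠ i ∧ v =ᶠ i) ≡ false
  apart i with u ≟ᶠ i | v ≟ᶠ i
  ... | yes refl | yes refl = ⊥-elim (u≢v refl)
  ... | yes _    | no _     = refl
  ... | no _     | _        = refl

nonEdges : SimpleGraph n → ℕ
nonEdges {n} G = ∑ (allFin n) (λ i → ∑ (allFin n) (λ j → ⟦ not (adj G i j) ⟧))

module AddEdge (G : SimpleGraph n) (u v : Fin n) (u≢v : u ≢ v) where
  private G⁺ = addEdge G u v u≢v

  addEdge-⊇ : ∀ i j → adj G i j ≡ true → adj G⁺ i j ≡ true
  addEdge-⊇ i j h rewrite h = refl

  addEdge-cases : ∀ i j → adj G⁺ i j ≡ true → adj G i j ≡ true ⊎ (u ≡ i × v ≡ j) ⊎ (u ≡ j × v ≡ i)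
  addEdge-cases i j h with adj G i j
  ... | true  = inj₁ refl
  ... | false with (u =ᶠ i ∧ v =ᶠ j) in same
  ...   | true  = inj₂ (inj₁ (both same))
    where
    both : (u =ᶠ i ∧ v =ᶠ j) ≡ true → u ≡ i × v ≡ j
    both h = does-true (u ≟ᶠ i) (proj₁ (∧-true h)) , does-true (v ≟ᶠ j) (proj₂ (∧-true {u =ᶠ i} h))
  ...   | false = inj₂ (inj₂ (does-true (u ≟ᶠ j) (proj₁ (∧-true h)) , does-true (v ≟ᶠ i) (proj₂ (∧-true {u =ᶠ j} h))))

  avoiding : ∀ M → All (λ (a , b) → adj G⁺ a b ≡ true) M → u ∉ ends M → All (λ (a , b) → adj G a b ≡ true) M
  avoiding []            []           _  = []
  avoiding ((a , b) ∷ M) (ab ∷ edges) u∉ with addEdge-cases a b ab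
  ... | inj₁ ab′                = ab′ ∷ avoiding M edges (u∉ ∘ there ∘ there)
  ... | inj₂ (inj₁ (refl , _)) = ⊥-elim (u∉ (here refl))
  ... | inj₂ (inj₂ (refl , _)) = ⊥-elim (u∉ (there (here refl)))

  -- A matching uses the new edge at most once, and without it avoids both `u` and `v`. That `u` and
  -- `v` are ends of `M` is recorded because it separates them from the ends of the edges put back
  -- in the recursion.
  drop-edge : ∀ M → Matching G⁺ M → Matching G M ⊎
    (u ∈ ends M × v ∈ ends M × ∃ λ M₀ → Matching G M₀ × length M ≡ suc (length M₀) × ends M₀ ⊆ₗ ends M × u ∉ ends M₀ × v ∉ ends M₀)
  drop-edge [] _ = inj₁ ([] , [])
  drop-edge ((a , b) ∷ M) (ab ∷ edges , (a≢b ∷ a∉) ∷ b∉ ∷ uniq) with addEdge-cases a b ab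
  ... | inj₂ (inj₁ (refl , refl)) = inj₂ (here refl , there (here refl) , M
        , (avoiding M edges (λ w → All.lookup a∉ w refl) , uniq) , refl , there ∘ there
        , (λ w → All.lookup a∉ w refl) , (λ w → All.lookup b∉ w refl))
  ... | inj₂ (inj₂ (refl , refl)) = inj₂ (there (here refl) , here refl , M
        , (avoiding M edges (λ w → All.lookup b∉ w refl) , uniq) , refl , there ∘ there
        , (λ w → All.lookup b∉ w refl) , (λ w → All.lookup a∉ w refl))
  ... | inj₁ ab′ with drop-edge M (edges , uniq)
  ...   | inj₁ (edges′ , _) = inj₁ (ab′ ∷ edges′ , (a≢b ∷ a∉) ∷ b∉ ∷ uniq)
  ...   | inj₂ (u∈ , v∈ , M₀ , (edges₀ , uniq₀) , len , sub , u∉₀ , v∉₀) = inj₂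
        (there (there u∈) , there (there v∈) , (a , b) ∷ M₀
        , (ab′ ∷ edges₀ , (a≢b ∷ All.tabulate (All.lookup a∉ ∘ sub)) ∷ All.tabulate (All.lookup b∉ ∘ sub) ∷ uniq₀)
        , cong suc len
        , (λ { (here refl) → here refl ; (there (here refl)) → there (here refl) ; (there (there w)) → there (there (sub w)) })
        , avoid u∈ u∉₀ , avoid v∈ v∉₀)
    where
    avoid : ∀ {x} → x ∈ ends M → x ∉ ends M₀ → x ∉ (a ∷ b ∷ ends M₀)
    avoid x∈ x∉ (here refl)         = All.lookup a∉ x∈ refl
    avoid x∈ x∉ (there (here refl)) = All.lookup b∉ x∈ refl
    avoid x∈ x∉ (there (there w))   = x∉ w

  -- A matching of `suc c` edges would have to use `uv`, leaving `c` edges of `G` that miss `u` and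
  -- `v`; the degree sum then lets `augment` produce `suc c` edges in `G` itself.
  addEdge-bound : ∀ {c} → MatchingBound G c → suc (2 * c) ≤ degree G u + degree G v → MatchingBound G⁺ c
  addEdge-bound {c} bound big M match with drop-edge M match
  ... | inj₁ match′ = bound M match′
  ... | inj₂ (_ , _ , M₀ , match₀ , len , _ , u∉ , v∉) with m≤n⇒m<n∨m≡n (bound M₀ match₀)
  ...   | inj₁ lt   = subst (_≤ c) (≡-sym len) lt
  ...   | inj₂ refl with Augment.augment G u≢v M₀ match₀ u∉ v∉ big
  ...     | M₁ , match₁ , len₁ = ⊥-elim (1+n≰n (subst (_≤ c) len₁ (bound M₁ match₁)))

  -- The termination measure of `closure`. It counts ordered pairs, and the loss of the pair
  -- `(u , v)` alone is enough for a strict decrease.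
  nonEdges-drop : adj G u v ≡ false → suc (nonEdges G⁺) ≤ nonEdges G
  nonEdges-drop uv = begin
    1 + nonEdges G⁺
      ≡⟨ cong (_+ nonEdges G⁺) (Finite.once (finiteFin n) u) ⟨
    ∑ (allFin n) (λ i → 𝟙 (u ≟ᶠ i)) + nonEdges G⁺
      ≡⟨ ∑-+ (allFin n) _ _ ⟨
    ∑ (allFin n) (λ i → 𝟙 (u ≟ᶠ i) + ∑ (allFin n) (λ j → ⟦ not (adj G⁺ i j) ⟧))
      ≡⟨ ∑-cong (allFin n) (λ i → cong (_+ ∑ (allFin n) (λ j → ⟦ not (adj G⁺ i j) ⟧))
           (≡-sym (∑Fin-δ v (λ _ → 𝟙 (u ≟ᶠ i))))) ⟩
    ∑ (allFin n) (λ i → ∑ (allFin n) (λ j → 𝟙 (v ≟ᶠ j) * 𝟙 (u ≟ᶠ i)) + ∑ (allFin n) (λ j → ⟦ not (adj G⁺ i j) ⟧))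
      ≡⟨ ∑-cong (allFin n) (λ i → ≡-sym (∑-+ (allFin n) _ _)) ⟩
    ∑ (allFin n) (λ i → ∑ (allFin n) (λ j → 𝟙 (v ≟ᶠ j) * 𝟙 (u ≟ᶠ i) + ⟦ not (adj G⁺ i j) ⟧))
      ≤⟨ ∑-mono (allFin n) (λ i → ∑-mono (allFin n) (at i)) ⟩
    nonEdges G ∎
    where
    open ≤-Reasoning
    no-loss : ∀ x {y} → not (x ∨ y) ≡ true → not x ≡ true
    no-loss false _ = refl
    at : ∀ i j → 𝟙 (v ≟ᶠ j) * 𝟙 (u ≟ᶠ i) + ⟦ not (adj G⁺ i j) ⟧ ≤ ⟦ not (adj G i j) ⟧
    at i j with v ≟ᶠ j | u ≟ᶠ i
    ... | yes refl | yes refl rewrite uv = ≤-refl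
    ... | yes _    | no _     = ⟦⟧-mono (no-loss (adj G i j))
    ... | no _     | _        = ⟦⟧-mono (no-loss (adj G i j))

Closed : SimpleGraph n → ℕ → Set
Closed G c = ∀ u v → u ≢ v → adj G u v ≡ false → degree G u + degree G v ≤ 2 * c

-- The Bondy–Chvátal closure for the property of having no c + 1 disjoint edges.
closure : ∀ (G : SimpleGraph n) c → MatchingBound G c →
          ∃ λ G′ → (∀ i j → adj G i j ≡ true → adj G′ i j ≡ true) × MatchingBound G′ c × Closed G′ c
closure {n} G c = go _ G ≤-refl
  where
  go : ∀ fuel G → nonEdges G ≤ fuel → MatchingBound G c →
       ∃ λ G′ → (∀ i j → adj G i j ≡ true → adj G′ i j ≡ true) × MatchingBound G′ c × Closed G′ c
  go fuel G le bound with any? (λ u → any? λ v → ¬? (u ≟ᶠ v) ×-dec (adj G u v ≟ᵇ false) ×-dec (suc (2 * c) ≤? degree G u + degree G v))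
  ... | no none = G , (λ _ _ h → h) , bound , λ u v u≢v uv → ≮⇒≥ (λ lt → none (u , v , u≢v , uv , lt))
  ... | yes (u , v , u≢v , uv , big) with fuel | ≤-trans (AddEdge.nonEdges-drop G u v u≢v uv) le
  ...   | suc fuel′ | s≤s le′ with go fuel′ (addEdge G u v u≢v) le′ (AddEdge.addEdge-bound G u v u≢v bound big)
  ...     | G′ , sup , bound′ , closed = G′ , (λ i j h → sup i j (AddEdge.addEdge-⊇ G u v u≢v i j h)) , bound′ , closed

clique-matching : ∀ (G : SimpleGraph n) j xs → AllPairs (λ x y → adj G x y ≡ true) xs → Unique xs → j + j ≤ length xs →
                  ∃ λ M → Matching G M × length M ≡ j × ends M ⊆ₗ xs
clique-matching G zero    xs _ _ _ = [] , ([] , []) , refl , λ ()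
clique-matching G (suc j) (x ∷ []) _ _ (s≤s le) with () ← subst (_≤ 0) (+-suc j j) le
clique-matching G (suc j) (x ∷ y ∷ xs) ((xy ∷ _) ∷ _ ∷ adjs) ((x≢y ∷ x∉) ∷ y∉ ∷ uniq) (s≤s le)
  with clique-matching G j xs adjs uniq (≤-pred (subst (_≤ suc (length xs)) (+-suc j j) le))
... | M , (edges , uniq′) , len , sub = (x , y) ∷ M
      , (xy ∷ edges , (x≢y ∷ All.tabulate (All.lookup x∉ ∘ sub)) ∷ All.tabulate (All.lookup y∉ ∘ sub) ∷ uniq′)
      , cong suc len
      , λ { (here refl) → here refl ; (there (here refl)) → there (here refl) ; (there (there w)) → there (there (sub w)) }

-- Pairing off the vertices of a clique on `2 * c + 2` vertices would give `suc c` disjoint edges.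
clique-size : ∀ (G : SimpleGraph n) c (W : VSet n) → MatchingBound G c →
              (∀ u v → W u ≡ true → W v ≡ true → u ≢ v → adj G u v ≡ true) → size W ≤ suc (2 * c)
clique-size {n} G c W bound clique = ≮⇒≥ too-big
  where
  open import Data.List.Relation.Unary.Unique.Propositional.Properties using (allFin⁺; filter⁺)
  open import Data.List.Relation.Unary.All.Properties using (all-filter)
  members = List.filter (λ v → W v ≟ᵇ true) (allFin n)

  length-members : ∀ xs → length (List.filter (λ v → W v ≟ᵇ true) xs) ≡ countB W xs
  length-members []       = refl
  length-members (x ∷ xs) with W x
  ... | true  = cong suc (length-members xs)
  ... | false = length-members xs

  pairwise : ∀ xs → All (λ v → W v ≡ true) xs → Unique xs → AllPairs (λ x y → adj G x y ≡ true) xs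
  pairwise []       []        []          = []
  pairwise (x ∷ xs) (Wx ∷ Ws) (x∉ ∷ uniq) =
    All.zipWith (λ (Wy , x≢y) → clique x _ Wx Wy x≢y) (Ws , x∉) ∷ pairwise xs Ws uniq

  uniq : Unique members
  uniq = filter⁺ (λ v → W v ≟ᵇ true) (allFin⁺ n)

  too-big : ¬ (suc (2 * c) < size W)
  too-big lt with clique-matching G (suc c) members (pairwise members (all-filter (λ v → W v ≟ᵇ true) (allFin n)) uniq) uniq
                    (≤-trans (≤-reflexive (double c)) (≤-trans lt (≤-reflexive (≡-sym (length-members (allFin n))))))
    where
    double : ∀ c → suc c + suc c ≡ suc (suc (2 * c))
    double = solve-∀
  ... | M , match , len , _ = 1+n≰n (subst (_≤ c) len (bound M match))

-- Comparison with G(n, 2c, t)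

module Peeling {r n : ℕ} (H : SimpleGraph r) (G : SimpleGraph n) where
  open Embeddings H G
  open Roles H
  open Removal H G

  embs-mono : ∀ {W W′} → W ⊆ W′ → embs W ≤ embs W′
  embs-mono {W} {W′} W⊆W′ = ∑-mono (vecsOver (allFin n) r) (λ φ → 𝟙-mono (emb? W φ) (emb? W′ φ)
    (λ (mem , rest) → (λ i → W⊆W′ (lookup φ i) (mem i)) , rest))

  size-after : ∀ (U : VSet n) v {m} → U v ≡ true → size U ≡ suc m → size (minus U v) ≡ m
  size-after U v Uv eq = suc-injective (trans (≡-sym (size-minus-∈ U v Uv)) eq)

  remove-bound : ∀ t U v m → U v ≡ true → size U ≡ suc m → degIn U v ≤ t →
                 embs U ≤ embs (minus U v) + f t m
  remove-bound t U v m Uv eq d≤t = ≤-trans (embs-remove U v Uv)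
    (+-monoʳ-≤ (embs (minus U v)) (f-mono d≤t (≤-reflexive (size-after U v Uv eq))))

  -- The degrees are bounded in all of `G`, so any vertex of `U` outside `W` may be deleted next.
  -- Once only `W` is left, the bound by injections is the starting value of `grow`.
  peel : ∀ t W → (∀ v → W v ≡ false → degree G v ≤ t) →
         ∀ j U → W ⊆ U → size U ≡ size W + j → embs U ≤ grow t (size W) j
  peel t W low zero    U W⊆U eq = subst (λ z → embs U ≤ ff z r) (trans eq (+-identityʳ (size W))) (embs-≤-ff U)
  peel t W low (suc j) U W⊆U eq with any? (λ v → (U v ≟ᵇ true) ×-dec (W v ≟ᵇ false))
  ... | yes (v , Uv , v∉W) = ≤-trans
        (remove-bound t U v (size W + j) Uv eq′ (≤-trans (degIn≤degree U v) (low v v∉W)))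
        (+-monoˡ-≤ (f t (size W + j)) (peel t W low j (minus U v) W⊆U-v (size-after U v Uv eq′)))
    where
    eq′ : size U ≡ suc (size W + j)
    eq′ = trans eq (+-suc (size W) j)
    W⊆U-v : W ⊆ minus U v
    W⊆U-v u Wu = minus-complete U {v} {u} (W⊆U u Wu) (λ { refl → true≢false Wu v∉W })
  ... | no none = ⊥-elim (m+1+n≰m (size W) (subst (_≤ size W) eq (size-mono U⊆W)))
    where
    U⊆W : U ⊆ W
    U⊆W v Uv with W v in Wv
    ... | true  = refl
    ... | false = ⊥-elim (none (v , Uv , Wv))

  -- The last clause is the memory of the deletion: a vertex that had at most `c` neighbours left
  -- when deleted has at most `c` in `W`. It prevents outside vertices from being joined to all of
  -- the core.
  IsCore : ℕ → VSet n → Set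
  IsCore c W = 2 + c ≤ size W × (∀ v → W v ≡ true → suc c ≤ degIn W v) × (∀ v → W v ≡ false → degIn W v ≤ c)

  -- The hypothesis on the vertices outside `U` survives a deletion, since `U` only shrinks. If the
  -- deletion gets stuck, `U` itself is the core and the bound built up so far is abandoned.
  peel-or-core : ∀ c j U → size U ≡ suc c + j → (∀ v → U v ≡ false → degIn U v ≤ c) →
                 embs U ≤ grow c (suc c) j ⊎ ∃ (IsCore c)
  peel-or-core c zero    U eq low = inj₁ (subst (λ z → embs U ≤ ff z r) (trans eq (+-identityʳ (suc c))) (embs-≤-ff U))
  peel-or-core c (suc j) U eq low with any? (λ v → (U v ≟ᵇ true) ×-dec (degIn U v ≤? c))
  ... | no none = inj₂ (U , ≤-trans (≤-trans (s≤s (s≤s (m≤m+n c j))) (≤-reflexive (cong suc (≡-sym (+-suc c j))))) (≤-reflexive (≡-sym eq))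
                        , (λ v Uv → ≰⇒> (λ le → none (v , Uv , le))) , low)
  ... | yes (v , Uv , d≤c) with peel-or-core c j (minus U v) (size-after U v Uv eq′) low′
    where
    eq′ : size U ≡ suc (suc c + j)
    eq′ = trans eq (+-suc (suc c) j)
    shrink : minus U v ⊆ U
    shrink u h = proj₁ (minus-sound U v h)
    low′ : ∀ u → minus U v u ≡ false → degIn (minus U v) u ≤ c
    low′ u h with v ≟ᶠ u | U u in Uu
    ... | yes refl | _     = ≤-trans (degIn-mono shrink v) d≤c
    ... | no _     | false = ≤-trans (degIn-mono shrink u) (low u Uu)
    low′ u () | no _ | true
  ...   | inj₁ le   = inj₁ (≤-trans (remove-bound c U v (suc c + j) Uv (trans eq (+-suc (suc c) j)) d≤c)
                                    (+-monoˡ-≤ (f c (suc c + j)) le))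
  ...   | inj₂ core = inj₂ core

  module _ (c : ℕ) (bound : MatchingBound G c) (closed : Closed G c) where

    core-clique : ∀ W → IsCore c W → ∀ u v → W u ≡ true → W v ≡ true → u ≢ v → adj G u v ≡ true
    core-clique W (_ , high , _) u v Wu Wv u≢v with adj G u v in uv
    ... | true  = refl
    ... | false = ⊥-elim (<⇒≱ (s≤s (≤-trans (n≤1+n _) (≤-reflexive (double c)))) (≤-trans
            (+-mono-≤ (≤-trans (high u Wu) (degIn≤degree W u)) (≤-trans (high v Wv) (degIn≤degree W v)))
            (closed u v u≢v uv)))
      where
      double : ∀ c → suc (2 * c) ≡ c + suc c
      double = solve-∀

    -- Core vertices have degree at least `size W ∸ 1`. With a larger degree, `v` would have degree
    -- sum above `2 * c` with each of them, so by closedness it would be adjacent to all of `W`: at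
    -- least `c + 2` neighbours where at most `c` are allowed.
    outside-core : ∀ W → IsCore c W → ∀ v → W v ≡ false → degree G v ≤ 2 * c + 1 ∸ size W
    outside-core W core@(big , high , low) v v∉W = ≮⇒≥ λ lt →
      <⇒≱ big (≤-trans (≤-trans (size-mono {S = W} {W = λ u → W u ∧ adj G v u} (λ y Wy → ∧-intro Wy (joined lt y Wy))) (low v v∉W)) (n≤1+n c))
      where
      w≤ : size W ≤ 2 * c + 1
      w≤ = subst (size W ≤_) (+-comm 1 (2 * c)) (clique-size G c W bound (core-clique W core))
      joined : 2 * c + 1 ∸ size W < degree G v → ∀ y → W y ≡ true → adj G v y ≡ true
      joined lt y Wy with adj G v y in vy
      ... | true  = refl
      ... | false = ⊥-elim (1+n≰n (begin
        suc (2 * c)                                  ≡⟨ +-comm 1 (2 * c) ⟩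
        2 * c + 1                                    ≡⟨ m∸n+n≡m w≤ ⟨
        2 * c + 1 ∸ size W + size W                  ≡⟨ cong (2 * c + 1 ∸ size W +_) (size-minus-∈ W y Wy) ⟩
        2 * c + 1 ∸ size W + suc (size (minus W y))  ≡⟨ +-suc _ _ ⟩
        suc (2 * c + 1 ∸ size W) + size (minus W y)  ≤⟨ +-mono-≤ lt (size-mono {S = minus W y} {W = adj G y} others) ⟩
        degree G v + degree G y                      ≤⟨ closed v y v≢y vy ⟩
        2 * c ∎))
        where
        open ≤-Reasoning
        v≢y : v ≢ y
        v≢y refl = true≢false Wy v∉W
        others : minus W y ⊆ adj G y
        others u h = let Wu , y≢u = minus-sound W y h in core-clique W core y u Wy Wu y≢u

    -- Without a core the bound is the one for `c`, since `2 * c + 1 ∸ c` is `suc c`. With a core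
    -- the count starts afresh from all vertices, by `peel` with the threshold `t` for which
    -- `2 * c + 1 ∸ t` is the size of the core.
    embs≤F : ∀ k → 2 * c + 2 ≤ n → (∀ v → k ≤ degree G v) →
             embs full ≤ F n c c ⊎ ∃ λ t → k ≤ t × t ≤ c × embs full ≤ F n c t
    embs≤F k n≥ δ≥k with peel-or-core c (n ∸ suc c) full (trans size-full (≡-sym (m+[n∸m]≡n c<n))) (λ _ ())
      where
      c<n : c < n
      c<n = ≤-trans (s≤s (m≤m+n c _)) (≤-trans (n≤1+n _) (≤-trans (≤-reflexive (+-comm 2 (2 * c))) n≥))
    ... | inj₁ le = inj₁ (subst (λ w → embs full ≤ grow c w (n ∸ w)) (≡-sym w≡) le)
      where
      w≡ : 2 * c + 1 ∸ c ≡ suc c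
      w≡ = trans (cong (_∸ c) (split c)) (m+n∸n≡m (suc c) c)
        where
        split : ∀ c → 2 * c + 1 ≡ suc c + c
        split = solve-∀
    ... | inj₂ (W , core@(big , _)) = inj₂ (t , k≤t , t≤c , subst (λ w → embs full ≤ grow t w (n ∸ w)) (≡-sym (m∸[m∸n]≡n w≤))
            (peel t W (outside-core W core) (n ∸ size W) full (λ _ _ → refl)
              (trans size-full (≡-sym (m+[n∸m]≡n (≤-trans w≤ (≤-trans (+-monoʳ-≤ (2 * c) (s≤s z≤n)) n≥)))))))
      where
      t = 2 * c + 1 ∸ size W
      w≤ : size W ≤ 2 * c + 1
      w≤ = subst (size W ≤_) (+-comm 1 (2 * c)) (clique-size G c W bound (core-clique W core))
      t≤c : t ≤ c
      t≤c = ≤-trans (∸-monoʳ-≤ (2 * c + 1) (≤-trans (n≤1+n (suc c)) big))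
              (≤-reflexive (trans (cong (_∸ suc c) (split c)) (m+n∸n≡m c (suc c))))
        where
        split : ∀ c → 2 * c + 1 ≡ c + suc c
        split = solve-∀
      k≤t : k ≤ t
      -- The core has at most `2 * c + 1 < n` vertices, so some vertex lies outside; its degree is
      -- at least `k` and at most `t`.
      k≤t with any? (λ v → W v ≟ᵇ false)
      ... | yes (v , v∉W) = ≤-trans (δ≥k v) (outside-core W core v v∉W)
      ... | no none = ⊥-elim (1+n≰n (begin
        suc (2 * c + 1)   ≡⟨ +-suc (2 * c) 1 ⟨
        2 * c + 2         ≤⟨ n≥ ⟩
        n                 ≡⟨ size-full ⟨
        size (full {n})   ≤⟨ size-mono (λ v _ → everywhere v) ⟩
        size W            ≤⟨ w≤ ⟩
        2 * c + 1         ∎))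
        where
        open ≤-Reasoning
        everywhere : ∀ v → W v ≡ true
        everywhere v with W v in Wv
        ... | true  = refl
        ... | false = ⊥-elim (none (v , Wv))

-- The bound `F`: convexity in t, and embeddings into G(n, 2c, t)

∸-unsuc : ∀ {w n} → w < n → n ∸ w ≡ suc (n ∸ suc w)
∸-unsuc {zero}  (s≤s _)  = refl
∸-unsuc {suc w} (s≤s lt) = ∸-unsuc lt

module Profile {r : ℕ} (H : SimpleGraph r) (n c : ℕ) (n≥ : 2 * c + 2 ≤ n) where
  open Roles H

  width : ℕ → ℕ
  width t = 2 * c + 1 ∸ t

  width<n : ∀ t → width t < n
  width<n t = ≤-trans (s≤s (m∸n≤m (2 * c + 1) t)) (≤-trans (≤-reflexive (≡-sym (+-suc (2 * c) 1))) n≥)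

  F-convex : ∀ t → 2 + t ≤ c → 2 * F n c (1 + t) ≤ F n c t + F n c (2 + t)
  F-convex t le with m≤n⇒∃[o]m+o≡n le
  ... | s , refl = subst₂ _≤_ (cong (2 *_) (at (1 + t) (1 + w) (1 + j) w₁ j₁))
                              (cong₂ _+_ (at t (2 + w) j w₀ refl) (at (2 + t) w (2 + j) w₂ j₂))
                     (grow-convex j (s≤s (≤-trans (m≤m+n t _) (≤-trans (n≤1+n _) (n≤1+n _)))))
    where
    -- With `c = 2 + t + s`, this is the clique part for `2 + t`; those for `1 + t` and `t` are
    -- larger by one and two.
    w = 3 + (t + (s + s))
    j = n ∸ (2 + w)
    eq₀ : ∀ t s → 2 * (2 + t + s) + 1 ≡ 2 + (3 + (t + (s + s))) + t
    eq₀ = solve-∀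
    eq₁ : ∀ t s → 2 * (2 + t + s) + 1 ≡ 1 + (3 + (t + (s + s))) + (1 + t)
    eq₁ = solve-∀
    eq₂ : ∀ t s → 2 * (2 + t + s) + 1 ≡ 3 + (t + (s + s)) + (2 + t)
    eq₂ = solve-∀
    w₀ : width t ≡ 2 + w
    w₀ = trans (cong (_∸ t) (eq₀ t s)) (m+n∸n≡m (2 + w) t)
    w₁ : width (1 + t) ≡ 1 + w
    w₁ = trans (cong (_∸ (1 + t)) (eq₁ t s)) (m+n∸n≡m (1 + w) (1 + t))
    w₂ : width (2 + t) ≡ w
    w₂ = trans (cong (_∸ (2 + t)) (eq₂ t s)) (m+n∸n≡m w (2 + t))
    j₁ : n ∸ (1 + w) ≡ 1 + j
    j₁ = ∸-unsuc (subst (_< n) w₁ (width<n (1 + t)))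
    j₂ : n ∸ w ≡ 2 + j
    j₂ = trans (∸-unsuc (subst (_< n) w₂ (width<n (2 + t)))) (cong suc j₁)
    at : ∀ t w j → width t ≡ w → n ∸ w ≡ j → grow t w j ≡ F n c t
    at t w j refl refl = refl

  -- `Gnck` lists the dominating vertices first, then the rest of the clique, then the independent
  -- set. Hence the dominating set, the clique and every stage of adding vertices are initial
  -- segments.
  below : ℕ → VSet n
  below m v = toℕ v <ᵇ m

  size-below : ∀ {m} → m ≤ n → size (below m) ≡ m
  size-below = go n
    where
    go : ∀ n {m} → m ≤ n → ∑ (allFin n) (λ v → ⟦ toℕ v <ᵇ m ⟧) ≡ m
    go n       z≤n             = ∑-zero (allFin n)
    go (suc n) (s≤s {m} m≤n) = trans (∑-allFin-suc {n} (λ v → ⟦ toℕ v <ᵇ suc m ⟧)) (cong suc (go n m≤n))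

  below-sound : ∀ {m} v → below m v ≡ true → toℕ v < m
  below-sound {m} v = does-true (toℕ v <? m)

  below-complete : ∀ {m} v → toℕ v < m → below m v ≡ true
  below-complete {m} v = dec-true (toℕ v <? m)

  below-mono : ∀ {l m} → l ≤ m → below l ⊆ below m
  below-mono l≤m v h = below-complete v (≤-trans (below-sound v h) l≤m)

  module _ (multipartite : ∀ x y z → adj H x y ≡ false → adj H x z ≡ false → adj H y z ≡ false)
           (t : ℕ) (t≤c : t ≤ c) where
    private Gₜ = Gnck n (2 * c) t
    open Embeddings H Gₜ
    open Removal H Gₜ
    open Peeling H Gₜ using (embs-mono)

    t≤width : t ≤ width t
    t≤width = m+n≤o⇒m≤o∸n t (≤-trans (+-mono-≤ t≤c t≤c) (≤-trans (≤-reflexive (cong (c +_) (≡-sym (+-identityʳ c)))) (m≤m+n (2 * c) 1)))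

    distinct : ∀ {u v : Fin n} → u ≢ v → not (toℕ u ≡ᵇ toℕ v) ≡ true
    distinct {u} {v} u≢v = cong not (dec-false (toℕ u ℕₚ.≟ toℕ v) (u≢v ∘ Finₚ.toℕ-injective))

    dominating : ∀ u v → below t u ≡ true → u ≢ v → adj Gₜ u v ≡ true
    dominating u v h u≢v rewrite h = ∧-intro (distinct u≢v) refl

    clique : ∀ u v → below (width t) u ≡ true → below (width t) v ≡ true → u ≢ v → adj Gₜ u v ≡ true
    clique u v hu hv u≢v = ∧-intro (distinct u≢v) linked
      where
      linked : link (cls (2 * c) t (toℕ u)) (cls (2 * c) t (toℕ v)) ≡ true
      linked rewrite hu | hv with toℕ u <ᵇ t | toℕ v <ᵇ t
      ... | true  | _     = refl
      ... | false | true  = refl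
      ... | false | false = refl

    -- The vertices after the clique join in the order of their indices. For each of them `below t`
    -- serves as the neighbourhood in `embs-add`: its vertices are adjacent to all others.
    grow≤embs : ∀ j → width t + j ≤ n → grow t (width t) j ≤ embs (below (width t + j))
    grow≤embs zero le = subst (λ w → ff (width t) r ≤ embs (below w)) (≡-sym (+-identityʳ (width t)))
      (subst (λ z → ff z r ≤ embs (below (width t))) (size-below (<⇒≤ (width<n t))) (ff-≤-embs (below (width t)) clique))
    grow≤embs (suc j) le = begin
      grow t (width t) j + f t (width t + j)
        ≤⟨ +-monoˡ-≤ _ (grow≤embs j (<⇒≤ lt)) ⟩
      embs (below (width t + j)) + f t (width t + j)
        ≡⟨ cong₂ (λ x y → embs (below (width t + j)) + f x y)
             (size-below (≤-trans t≤width (<⇒≤ (width<n t)))) (size-below (<⇒≤ lt)) ⟨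
      embs (below (width t + j)) + f (size (below t)) (size (below (width t + j)))
        ≤⟨ embs-add multipartite (below (width t + suc j)) (below (width t + j)) (below t) v
             (below-complete v (≤-reflexive (trans (cong suc v≡) (≡-sym (+-suc (width t) j)))))
             (below-mono (+-monoʳ-≤ (width t) (n≤1+n j)))
             (¬-not (λ h → <-irrefl v≡ (below-sound v h)))
             (below-mono (≤-trans t≤width (m≤m+n (width t) j))) dominating ⟩
      embs (below (width t + suc j)) ∎
      where
      open ≤-Reasoning
      lt : width t + j < n
      lt = subst (_≤ n) (+-suc (width t) j) le
      v = Fin.fromℕ< lt
      v≡ : toℕ v ≡ width t + j
      v≡ = Finₚ.toℕ-fromℕ< lt

    F≤embs : F n c t ≤ embs full
    F≤embs = ≤-trans (grow≤embs (n ∸ width t) (≤-reflexive (m+[n∸m]≡n (<⇒≤ (width<n t))))) (embs-mono {below (width t + (n ∸ width t))} (λ _ _ → refl))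

-- The bound for complete multipartite graphs

K-multipartite : ∀ rs x y z → adj (K rs) x y ≡ false → adj (K rs) x z ≡ false → adj (K rs) y z ≡ false
K-multipartite rs x y z xy xz = trans
  (cong₂ (λ a b → not (a ≡ᵇ b)) (≡-sym (same (part rs x) (part rs y) xy)) (≡-sym (same (part rs x) (part rs z) xz))) (cong not (≡ᵇ-refl (part rs x)))
  where
  same : ∀ a b → not (a ≡ᵇ b) ≡ false → a ≡ b
  same a b h with a ≡ᵇ b in eq
  ... | true = does-true (a ℕₚ.≟ b) eq

embs-⊆ : ∀ (H : SimpleGraph r) (G G′ : SimpleGraph n) → (∀ i j → adj G i j ≡ true → adj G′ i j ≡ true) →
         Embeddings.embs H G full ≤ Embeddings.embs H G′ full
embs-⊆ {r} {n} H G G′ G⊆G′ = ∑-mono (vecsOver (allFin n) r)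
  (λ φ → 𝟙-mono (Embeddings.emb? H G full φ) (Embeddings.emb? H G′ full φ)
    (λ (mem , inj , hom) → mem , inj , λ i j h → G⊆G′ _ _ (hom i j h)))

theorem3 : (rs : List ℕ) → All (λ r → 1 ≤ r) rs →
    (n α′ k : ℕ) (G : SimpleGraph n) →
    2 * α′ + 2 ≤ n → MatchingNumber G α′ → MinDegreeAtLeast G k →
    N (K rs) G ≤ g rs n (2 * α′) k ⊔ g rs n (2 * α′) α′
theorem3 rs _ n α′ k G n≥ (_ , maximum) δ≥k with
  closure G α′ (λ M match → maximum (length M) (List.lookup M) (matching⇒IsMatching G M match))
... | G′ , G⊆G′ , bound , closed =
    -- The closure only adds edges, so the minimum degree condition passes to `G′`.
    conclude (Peeling.embs≤F (K rs) G′ α′ bound closed k n≥ (λ v → ≤-trans (δ≥k v) (size-mono (G⊆G′ v))))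
  where
  open Roles (K rs)
  open Profile (K rs) n α′ n≥
  embs = Embeddings.embs (K rs) G′ full

  extremal : ∀ t → t ≤ α′ → embs ≤ F n α′ t → N (K rs) G ≤ g rs n (2 * α′) t
  extremal t t≤α′ le = copies-mono (K rs) G (Gnck n (2 * α′) t)
    (≤-trans (embs-⊆ (K rs) G G′ G⊆G′) (≤-trans le (F≤embs (K-multipartite rs) t t≤α′)))

  conclude : embs ≤ F n α′ α′ ⊎ (∃ λ t → k ≤ t × t ≤ α′ × embs ≤ F n α′ t) →
             N (K rs) G ≤ g rs n (2 * α′) k ⊔ g rs n (2 * α′) α′
  conclude (inj₁ le) = ≤-trans (extremal α′ ≤-refl le) (m≤n⊔m (g rs n (2 * α′) k) _)
  -- Convexity moves the bound from `t` to the better end of the interval while it is still a value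
  -- of `F`; only there does `extremal` turn it into copies. For the end `k`, the inequality
  -- `k ≤ α′` comes from `k ≤ t ≤ α′`.
  conclude (inj₂ (t , k≤t , t≤α′ , le))
    with ⊔-sel (F n α′ k) (F n α′ α′) | ≤-trans le (convex⇒≤ends (F n α′) α′ F-convex k≤t t≤α′)
  ... | inj₁ eq | le′ = ≤-trans (extremal k (≤-trans k≤t t≤α′) (subst (embs ≤_) eq le′)) (m≤m⊔n _ (g rs n (2 * α′) α′))
  ... | inj₂ eq | le′ = conclude (inj₁ (subst (embs ≤_) eq le′))
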